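{- Let $n\geq 4$ and let $T$ be any $2$-eared triangulation of a convex $n$-gon $P$. Then the number of triangulations of $P$ disjoint from $T$ is $C_{n-3}$, where $C_k=\frac{1}{k+1}\binom{2k}{k}$ is the $k$th Catalan number.
   Context: A triangulation of a convex polygon $P$ uses non-crossing diagonals to divide $P$ into triangles. An ear of a triangulation is a triangle of it sharing two sides with $P$; a triangulation is $2$-eared if it has exactly two ears. Two triangulations of $P$ are disjoint if they have no diagonals in common. -}

module Defs where

open import Level using (Level; _⊔_)
open import Data.Nat.Base as ℕ using (ℕ; suc; _*_)
open import Data.Nat.Combinatorics using (_C_)
open import Data.Nat.DivMod using (_/_)
open import Data.Fin.Base using (Fin; toℕ; _<_; _≤_)
open import Data.Fin.Subset using (Subset; _∈_; ∣_∣)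
open import Data.List.Base using (List; length)
import Data.List.Membership.Propositional as List
open import Data.List.Relation.Unary.Unique.Propositional using (Unique)
open import Data.Product.Base using (Σ-syntax; _×_; _,_)
open import Data.Sum.Base using (_⊎_)
open import Data.Vec.Base using (Vec; lookup)
open import Function.Bundles using (_⇔_)
open import Relation.Binary.PropositionalEquality using (_≡_)
open import Relation.Nullary.Negation using (¬_)

-- Exactly k elements of A satisfy P: some duplicate-free list of length k
-- consists of precisely those elements.
HasCount : ∀ {a p : Level} {A : Set a} → (A → Set p) → ℕ → Set (a ⊔ p)
HasCount {A = A} P k =
  Σ[ xs ∈ List A ] Unique xs × (∀ x → (x List.∈ xs) ⇔ P x) × length xs ≡ k

-- The division is exact, since k + 1 divides the central binomial coefficient.
catalan : ℕ → ℕ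
catalan k = ((2 * k) C k) / suc k

-- The vertices of the convex n-gon are the elements of Fin n, numbered in
-- cyclic order along the boundary.  A segment between two distinct vertices is
-- always written as the pair (i , j) of its endpoints with i < j.

Side : ∀ {n} → Fin n → Fin n → Set
Side {n} i j =
  i < j × (toℕ j ≡ suc (toℕ i) ⊎ (toℕ i ≡ 0 × suc (toℕ j) ≡ n))

Diagonal : ∀ {n} → Fin n → Fin n → Set
Diagonal i j = i < j × ¬ Side i j

-- A set of segments, stored as a Boolean matrix so that propositional equality
-- is equality of sets.
Segments : ℕ → Set
Segments n = Vec (Subset n) n

_∋⟨_,_⟩ : ∀ {n} → Segments n → Fin n → Fin n → Set
D ∋⟨ i , j ⟩ = j ∈ lookup D i

-- By convexity, the segments ij and kl meet in their interiors exactly when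
-- their endpoints alternate along the boundary, i.e. (up to exchanging the two
-- segments) when i < k < j < l.
Crossing : ∀ {n} → (i j k l : Fin n) → Set
Crossing i j k l = i < k × k < j × j < l

record NonCrossingDiagonals {n} (D : Segments n) : Set where
  field
    diagonals   : ∀ i j → D ∋⟨ i , j ⟩ → Diagonal i j
    nonCrossing : ∀ i j k l → D ∋⟨ i , j ⟩ → D ∋⟨ k , l ⟩ → ¬ Crossing i j k l

-- ij (with i < j) is an edge of the convex polygon spanned by the vertex set S:
-- either no vertex of S lies strictly between i and j, or i and j are the
-- first and last vertices of S.
Edge : ∀ {n} → Subset n → Fin n → Fin n → Set
Edge S i j =
  i ∈ S × j ∈ S × i < j ×
  ((∀ k → k ∈ S → ¬ (i < k × k < j)) ⊎ (∀ k → k ∈ S → i ≤ k × k ≤ j))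

-- The regions into which the non-crossing diagonals D divide the n-gon.  A
-- region is the convex polygon spanned by a set S of at least three vertices,
-- all of whose edges are sides of the n-gon or members of D, and which is not
-- divided further by a member of D.
record Region {n} (D : Segments n) (S : Subset n) : Set where
  field
    polygon   : 3 ℕ.≤ ∣ S ∣
    bounded   : ∀ i j → Edge S i j → Side i j ⊎ D ∋⟨ i , j ⟩
    undivided : ∀ i j → i ∈ S → j ∈ S → D ∋⟨ i , j ⟩ → Edge S i j

record Triangulation {n} (D : Segments n) : Set where
  field
    nonCrossingDiagonals : NonCrossingDiagonals D
    regionsAreTriangles  : ∀ S → Region D S → ∣ S ∣ ≡ 3

Ear : ∀ {n} → Segments n → Subset n → Set
Ear {n} D S =
  Region D S × ∣ S ∣ ≡ 3 ×
  HasCount {A = Fin n × Fin n} (λ (i , j) → Edge S i j × Side i j) 2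

TwoEared : ∀ {n} → Segments n → Set
TwoEared D = HasCount (Ear D) 2

Disjoint : ∀ {n} → Segments n → Segments n → Set
Disjoint D E = ∀ i j → ¬ (D ∋⟨ i , j ⟩ × E ∋⟨ i , j ⟩)

{-# OPTIONS --safe #-}
-- The triangulations of the polygon a, …, a + p + 1 are the binary trees with p
-- inner nodes: a node covering the vertices i, …, j is the segment ij, and its
-- two children are the other sides of the triangle below that segment.  A
-- triangulation T with two ears is a root with two chains below it, a chain being
-- a tree in which every node has a leaf child.
--
-- Forbid the nodes of a chain one at a time, from the innermost outwards.  The
-- trees lost on forbidding a segment are those containing it, and cutting along
-- it turns such a tree into a tree on the segment and a tree on the polygon with
-- the segment contracted to a side.  With c the Catalan numbers, forbidding the
-- nodes of the left chain, of size p, leaves Σ_{i ≤ j} c(p + i) c(j - i) trees of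
-- size p + j + 1, the tail of the Catalan recurrence.  Writing this as
-- (u * c)(j) with u(i) = c(p + i), forbidding the right chain, of size q, leaves
-- (u * c)(q) - Σ_{i < q} c(i) (u * c)(q - 1 - i), which is u(q) = c(p + q) because
-- c(i + 1) = (c * c)(i).

module Submission where

open import Data.Bool.Base using (Bool; true; false; if_then_else_; _∨_; _∧_)
open import Data.Bool.Properties using (∨-identityʳ; ∨-zeroʳ; ¬-not; T-≡)
open import Data.Empty using (⊥; ⊥-elim)
open import Data.Fin.Base as Fin using (Fin; toℕ; fromℕ<)
open import Data.Fin.Properties using (toℕ<n; toℕ-injective; toℕ-fromℕ<; all?; any?)
open import Data.Fin.Subset using (Subset; _∈_; ∣_∣; inside; outside; ⁅_⁆) renaming (_∪_ to _∪ˢ_; ⊥ to ∅ˢ)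
open import Data.Fin.Subset.Properties using (_∈?_; x∈p∧x≢y⇒x∈p-y; x∈p⇒∣p-x∣<∣p∣; ∣⊥∣≡0; ∣⁅x⁆∣≡1; x∈⁅x⁆; x∈⁅y⁆⇒x≡y; x∈p∪q⁺; x∈p∪q⁻; ∉⊥; p⊆q⇒∣p∣≤∣q∣; ⊆-antisym; nonempty?)
open import Data.List.Base using (List; []; _∷_; [_]; length; map; concat; applyUpTo; cartesianProductWith)
open import Data.List.Properties using (length-++; length-map)
import Data.List.Membership.Propositional as List
open import Data.List.Membership.Propositional.Properties using (∈-map⁺; ∈-map⁻; ∈-concat⁺′; ∈-concat⁻′; ∈-applyUpTo⁺; ∈-applyUpTo⁻; ∈-cartesianProductWith⁺; ∈-cartesianProductWith⁻)
open import Data.List.Relation.Unary.All as All using (All; []; _∷_)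
import Data.List.Relation.Unary.All.Properties as All
open import Data.List.Relation.Unary.AllPairs using ([]; _∷_)
import Data.List.Relation.Unary.AllPairs.Properties as AllPairs
open import Data.List.Relation.Unary.Any using (here; there)
open import Data.List.Relation.Unary.Unique.Propositional using (Unique)
import Data.List.Relation.Unary.Unique.Propositional.Properties as Unique
open import Data.Nat.Base using (ℕ; zero; suc; _+_; _*_; _∸_; _≤_; _<_; z≤n; s≤s; _≡ᵇ_; _!)
open import Data.Nat.Combinatorics using (_C_; nCk≡n!/k![n-k]!; k![n∸k]!∣n!)
open import Data.Nat.DivMod using (_/_; m/n*n≡m; m*n/n≡m)
open import Data.Nat.Properties
open import Data.Nat.Tactic.RingSolver using (solve-∀)
open import Data.Product.Base using (Σ-syntax; _×_; _,_; proj₁; proj₂)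
open import Data.Sum.Base as Sum using (_⊎_; inj₁; inj₂)
open import Data.Unit.Base using (⊤; tt)
open import Data.Vec.Base using (Vec; []; _∷_; lookup; tabulate)
open import Data.Vec.Properties using (lookup⇒[]=; []=⇒lookup; lookup∘tabulate; tabulate∘lookup; tabulate-cong)
open import Function.Base using (_∘_; _$_)
open import Function.Bundles using (_⇔_; mk⇔; Equivalence)
open import Relation.Binary.Definitions using (Tri; tri<; tri≈; tri>)
open import Relation.Binary.PropositionalEquality using (_≡_; _≢_; refl; sym; trans; cong; cong₂; subst; subst₂; module ≡-Reasoning)
open import Relation.Nullary.Decidable using (Dec; yes; no; does; _×-dec_; _⊎-dec_; _→-dec_; ¬?; dec-true)
open import Relation.Nullary.Negation using (¬_; contradiction)
open import Defs

-- Convolution and the Catalan numbers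

-- The order of removal makes the count work. When a node of size k + 1 is forbidden, every node of
-- its chain forbidden earlier lies below it, so contracting it swallows them all and the remaining
-- polygon knows nothing of the chain. The trees on that node avoiding the earlier ones number c(k)
-- however the chain turns: the induction formula for the node's own polygon leaves exactly the last
-- term of the recurrence for c(k + 1). Hence only the sizes p and q enter.
--
-- The chains are not removed independently, so the statement on one chain carries an arbitrary set
-- `ψ` of segments forbidden further left, and room for x vertices before and y vertices after the
-- chain.
--
-- The definitions speak of regions as vertex sets, the count of nested segments. The bridge is a
-- local form of maximality: each segment, the side from 0 to n - 1 included, has an apex joined to
-- both of its ends. Ears enter only through an upper bound: a tree that is not a root with two
-- chains has three ears, the triangle at the root being one of them if a child of the root is a
-- leaf.

∑ : ℕ → (ℕ → ℕ) → ℕ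
∑ zero    f = 0
∑ (suc n) f = f 0 + ∑ n (f ∘ suc)

∑-cong : ∀ n {f g : ℕ → ℕ} → (∀ i → i < n → f i ≡ g i) → ∑ n f ≡ ∑ n g
∑-cong zero    eq = refl
∑-cong (suc n) eq = cong₂ _+_ (eq 0 (s≤s z≤n)) (∑-cong n (λ i i<n → eq (suc i) (s≤s i<n)))

∑-distrib-+ : ∀ n (f g : ℕ → ℕ) → ∑ n (λ i → f i + g i) ≡ ∑ n f + ∑ n g
∑-distrib-+ zero    f g = refl
∑-distrib-+ (suc n) f g rewrite ∑-distrib-+ n (f ∘ suc) (g ∘ suc) =
  interchange (f 0) (g 0) (∑ n (f ∘ suc)) (∑ n (g ∘ suc))
  where
  interchange : ∀ a b c d → a + b + (c + d) ≡ a + c + (b + d)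
  interchange = solve-∀

∑-distribˡ-* : ∀ n c (f : ℕ → ℕ) → ∑ n (λ i → c * f i) ≡ c * ∑ n f
∑-distribˡ-* zero    c f = sym (*-zeroʳ c)
∑-distribˡ-* (suc n) c f rewrite ∑-distribˡ-* n c (f ∘ suc) =
  sym (*-distribˡ-+ c (f 0) (∑ n (f ∘ suc)))

∑-split : ∀ m n (f : ℕ → ℕ) → ∑ (m + n) f ≡ ∑ m f + ∑ n (λ i → f (m + i))
∑-split zero    n f = refl
∑-split (suc m) n f rewrite ∑-split m n (f ∘ suc) =
  sym (+-assoc (f 0) (∑ m (f ∘ suc)) _)

∑-suc : ∀ n (f : ℕ → ℕ) → ∑ (suc n) f ≡ ∑ n f + f n
∑-suc zero    f = +-identityʳ (f 0)
∑-suc (suc n) f = trans (cong (f 0 +_) (∑-suc n (f ∘ suc))) (sym (+-assoc (f 0) _ _))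

conv : (ℕ → ℕ) → (ℕ → ℕ) → ℕ → ℕ
conv f g n = ∑ (suc n) (λ i → f i * g (n ∸ i))

conv-cong : ∀ {f f′ g g′ : ℕ → ℕ} n → (∀ i → i ≤ n → f i ≡ f′ i) → (∀ i → i ≤ n → g i ≡ g′ i) →
            conv f g n ≡ conv f′ g′ n
conv-cong n f≡ g≡ = ∑-cong (suc n) λ { i (s≤s i≤n) → cong₂ _*_ (f≡ i i≤n) (g≡ (n ∸ i) (m∸n≤m n i)) }

conv-distribʳ-+ : ∀ (f f′ g : ℕ → ℕ) n → conv (λ i → f i + f′ i) g n ≡ conv f g n + conv f′ g n
conv-distribʳ-+ f f′ g n =
  trans (∑-cong (suc n) (λ i _ → *-distribʳ-+ (g (n ∸ i)) (f i) (f′ i)))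
        (∑-distrib-+ (suc n) (λ i → f i * g (n ∸ i)) (λ i → f′ i * g (n ∸ i)))

conv-*ˡ : ∀ c (f g : ℕ → ℕ) n → conv (λ i → c * f i) g n ≡ c * conv f g n
conv-*ˡ c f g n =
  trans (∑-cong (suc n) (λ i _ → *-assoc c (f i) (g (n ∸ i))))
        (∑-distribˡ-* (suc n) c (λ i → f i * g (n ∸ i)))

conv-sucʳ : ∀ (f g : ℕ → ℕ) n → conv f g (suc n) ≡ conv f (g ∘ suc) n + f (suc n) * g 0
conv-sucʳ f g n = begin
  conv f g (suc n)
    ≡⟨ ∑-suc (suc n) (λ i → f i * g (suc n ∸ i)) ⟩
  ∑ (suc n) (λ i → f i * g (suc n ∸ i)) + f (suc n) * g (n ∸ n)
    ≡⟨ cong₂ _+_ (∑-cong (suc n) λ { i (s≤s i≤n) → cong (λ k → f i * g k) (+-∸-assoc 1 i≤n) })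
                 (cong (λ k → f (suc n) * g k) (n∸n≡0 n)) ⟩
  conv f (g ∘ suc) n + f (suc n) * g 0 ∎
  where open ≡-Reasoning

conv-comm : ∀ (f g : ℕ → ℕ) n → conv f g n ≡ conv g f n
conv-comm f g zero    = cong (_+ 0) (*-comm (f 0) (g 0))
conv-comm f g (suc n) = begin
  f 0 * g (suc n) + conv (f ∘ suc) g n ≡⟨ +-comm (f 0 * g (suc n)) _ ⟩
  conv (f ∘ suc) g n + f 0 * g (suc n) ≡⟨ cong₂ _+_ (conv-comm (f ∘ suc) g n) (*-comm (f 0) (g (suc n))) ⟩
  conv g (f ∘ suc) n + g (suc n) * f 0 ≡⟨ conv-sucʳ g f n ⟨
  conv g f (suc n) ∎
  where open ≡-Reasoning

conv-assoc : ∀ (f g h : ℕ → ℕ) n → conv (conv f g) h n ≡ conv f (conv g h) n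
conv-assoc f g h zero    = reassoc (f 0) (g 0) (h 0)
  where
  reassoc : ∀ a b c → (a * b + 0) * c + 0 ≡ a * (b * c + 0) + 0
  reassoc = solve-∀
conv-assoc f g h (suc n) = begin
  (f 0 * g 0 + 0) * h (suc n) + conv (λ i → f 0 * g (suc i) + conv (f ∘ suc) g i) h n
    ≡⟨ cong ((f 0 * g 0 + 0) * h (suc n) +_) (conv-distribʳ-+ (λ i → f 0 * g (suc i)) (conv (f ∘ suc) g) h n) ⟩
  (f 0 * g 0 + 0) * h (suc n) + (conv (λ i → f 0 * g (suc i)) h n + conv (conv (f ∘ suc) g) h n)
    ≡⟨ cong₂ (λ u v → (f 0 * g 0 + 0) * h (suc n) + (u + v))
             (conv-*ˡ (f 0) (g ∘ suc) h n) (conv-assoc (f ∘ suc) g h n) ⟩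
  (f 0 * g 0 + 0) * h (suc n) + (f 0 * conv (g ∘ suc) h n + conv (f ∘ suc) (conv g h) n)
    ≡⟨ reassoc (f 0) (g 0) (h (suc n)) (conv (g ∘ suc) h n) _ ⟩
  f 0 * (g 0 * h (suc n) + conv (g ∘ suc) h n) + conv (f ∘ suc) (conv g h) n ∎
  where
  open ≡-Reasoning
  reassoc : ∀ a b c d e → (a * b + 0) * c + (a * d + e) ≡ a * (b * c + d) + e
  reassoc = solve-∀

weighted : (ℕ → ℕ) → ℕ → ℕ
weighted f i = i * f i

-- Reversing the sum pairs the weights i and n - i, so the weight averages to n / 2.
conv-weighted : ∀ (f : ℕ → ℕ) n → 2 * conv (weighted f) f n ≡ n * conv f f n
conv-weighted f n = begin
  2 * conv (weighted f) f n
    ≡⟨ cong (conv (weighted f) f n +_) (+-identityʳ _) ⟩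
  conv (weighted f) f n + conv (weighted f) f n
    ≡⟨ cong (conv (weighted f) f n +_) (conv-comm (weighted f) f n) ⟩
  conv (weighted f) f n + conv f (weighted f) n
    ≡⟨ ∑-distrib-+ (suc n) (λ i → weighted f i * f (n ∸ i)) (λ i → f i * weighted f (n ∸ i)) ⟨
  ∑ (suc n) (λ i → weighted f i * f (n ∸ i) + f i * weighted f (n ∸ i))
    ≡⟨ ∑-cong (suc n) (λ { i (s≤s i≤n) → trans (collect i (f i) (n ∸ i) (f (n ∸ i)))
                                               (cong (_* (f i * f (n ∸ i))) (m+[n∸m]≡n i≤n)) }) ⟩
  ∑ (suc n) (λ i → n * (f i * f (n ∸ i)))
    ≡⟨ ∑-distribˡ-* (suc n) n (λ i → f i * f (n ∸ i)) ⟩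
  n * conv f f n ∎
  where
  open ≡-Reasoning
  collect : ∀ i x j y → i * x * y + x * (j * y) ≡ (i + j) * (x * y)
  collect = solve-∀

module SelfConvolution (c : ℕ → ℕ) (c-zero : c 0 ≡ 1) (c-suc : ∀ n → c (suc n) ≡ conv c c n) where

  -- Evaluate 2 Σ (i + 1) c(i) c(n + 1 - i) twice: by the symmetry i ↔ n + 1 - i, and
  -- by splitting off i = 0 and applying the recurrence below n + 1.
  recurrence : ∀ n → suc (suc n) * c (suc n) ≡ (4 * n + 2) * c n
  recurrence n = below (suc n) n ≤-refl
    where
    open ≡-Reasoning
    below : ∀ f n → n < f → suc (suc n) * c (suc n) ≡ (4 * n + 2) * c n
    below (suc f) zero    _         rewrite c-suc 0 | c-zero = refl
    below (suc f) (suc n) (s≤s n<f) = begin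
      suc (suc (suc n)) * c (suc (suc n))
        ≡⟨ cong (suc (suc (suc n)) *_) (c-suc (suc n)) ⟩
      suc (suc (suc n)) * conv c c (suc n)
        ≡⟨ *-distribʳ-+ (conv c c (suc n)) 2 (suc n) ⟩
      2 * conv c c (suc n) + suc n * conv c c (suc n)
        ≡⟨ cong (2 * conv c c (suc n) +_) (conv-weighted c (suc n)) ⟨
      2 * conv c c (suc n) + 2 * conv (weighted c) c (suc n)
        ≡⟨ *-distribˡ-+ 2 (conv c c (suc n)) _ ⟨
      2 * (conv c c (suc n) + conv (weighted c) c (suc n))
        ≡⟨ cong (2 *_) (conv-distribʳ-+ c (weighted c) c (suc n)) ⟨
      2 * conv (λ i → suc i * c i) c (suc n)
        ≡⟨⟩
      2 * (1 * c 0 * c (suc n) + conv (λ i → suc (suc i) * c (suc i)) c n)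
        ≡⟨ cong₂ (λ u v → 2 * (1 * u * c (suc n) + v)) c-zero
             (trans (conv-cong {g = c} n (λ i i≤n → trans (below f i (≤-<-trans i≤n n<f)) (expand i (c i))) (λ _ _ → refl))
             (trans (conv-distribʳ-+ (λ i → 4 * weighted c i) (λ i → 2 * c i) c n)
                    (cong₂ _+_ (conv-*ˡ 4 (weighted c) c n) (conv-*ˡ 2 c c n)))) ⟩
      2 * (1 * 1 * c (suc n) + (4 * conv (weighted c) c n + 2 * conv c c n))
        ≡⟨ regroup (c (suc n)) (conv (weighted c) c n) (conv c c n) ⟩
      2 * (c (suc n) + (2 * (2 * conv (weighted c) c n) + 2 * conv c c n))
        ≡⟨ cong₂ (λ u v → 2 * (c (suc n) + (2 * u + 2 * v)))
                 (trans (conv-weighted c n) (cong (n *_) (sym (c-suc n)))) (sym (c-suc n)) ⟩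
      2 * (c (suc n) + (2 * (n * c (suc n)) + 2 * c (suc n)))
        ≡⟨ finish n (c (suc n)) ⟩
      (4 * suc n + 2) * c (suc n) ∎
      where
      expand : ∀ i x → (4 * i + 2) * x ≡ 4 * (i * x) + 2 * x
      expand = solve-∀
      regroup : ∀ a b d → 2 * (1 * 1 * a + (4 * b + 2 * d)) ≡ 2 * (a + (2 * (2 * b) + 2 * d))
      regroup = solve-∀
      finish : ∀ n x → 2 * (x + (2 * (n * x) + 2 * x)) ≡ (4 * (1 + n) + 2) * x
      finish = solve-∀

  -- `recurrence` turns the step from k to k + 1 into the factor (2k + 1)(2k + 2) on both sides;
  -- division is postponed until the factorials cancel.
  factorial-form : ∀ k → suc k * c k * (k ! * k !) ≡ (2 * k) !
  factorial-form zero    rewrite c-zero = refl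
  factorial-form (suc k) = begin
    suc (suc k) * c (suc k) * (suc k * k ! * (suc k * k !))
      ≡⟨ cong (_* (suc k * k ! * (suc k * k !))) (recurrence k) ⟩
    (4 * k + 2) * c k * (suc k * k ! * (suc k * k !))
      ≡⟨ regroup k (c k) (k !) ⟩
    (2 + 2 * k) * ((1 + 2 * k) * (suc k * c k * (k ! * k !)))
      ≡⟨ cong (λ m → (2 + 2 * k) * ((1 + 2 * k) * m)) (factorial-form k) ⟩
    (2 + 2 * k) !
      ≡⟨ cong _! (*-suc 2 k) ⟨
    (2 * suc k) ! ∎
    where
    open ≡-Reasoning
    regroup : ∀ k x y → (4 * k + 2) * x * ((1 + k) * y * ((1 + k) * y)) ≡
                        (2 + 2 * k) * ((1 + 2 * k) * ((1 + k) * x * (y * y)))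
    regroup = solve-∀

  ≡catalan : ∀ k → c k ≡ catalan k
  ≡catalan k = begin
    c k                         ≡⟨ m*n/n≡m (c k) (suc k) ⟨
    c k * suc k / suc k         ≡⟨ cong (_/ suc k) (*-comm (c k) (suc k)) ⟩
    suc k * c k / suc k         ≡⟨ cong (_/ suc k) (*-cancelʳ-≡ (suc k * c k) ((2 * k) C k) (k ! * k !) (trans (factorial-form k) (sym binomial))) ⟩
    ((2 * k) C k) / suc k       ∎
    where
    open ≡-Reasoning
    instance
      _ = k !* k !≢0
      _ = k !* (2 * k ∸ k) !≢0
    2k∸k : 2 * k ∸ k ≡ k
    2k∸k = trans (m+n∸m≡n k (k + 0)) (+-identityʳ k)
    k≤2k : k ≤ 2 * k
    k≤2k = m≤m+n k (k + 0)
    binomial : ((2 * k) C k) * (k ! * k !) ≡ (2 * k) !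
    binomial = begin
      ((2 * k) C k) * (k ! * k !)
        ≡⟨ cong (λ j → ((2 * k) C k) * (k ! * j !)) 2k∸k ⟨
      ((2 * k) C k) * (k ! * (2 * k ∸ k) !)
        ≡⟨ cong (_* (k ! * (2 * k ∸ k) !)) (nCk≡n!/k![n-k]! k≤2k) ⟩
      ((2 * k) ! / (k ! * (2 * k ∸ k) !)) * (k ! * (2 * k ∸ k) !)
        ≡⟨ m/n*n≡m (k![n∸k]!∣n! k≤2k) ⟩
      (2 * k) ! ∎

-- Counting binary trees with forbidden nodes

data Shape : Set where
  leaf : Shape
  node : Shape → Shape → Shape

size : Shape → ℕ
size leaf       = 0
size (node l r) = suc (size l + size r)

-- χ i s forbids the node with s inner nodes on the vertices i, …, i + s + 1.
Forbidden : Set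
Forbidden = ℕ → ℕ → Bool

Avoids : Forbidden → ℕ → Shape → Set
Avoids χ a leaf       = ⊤
Avoids χ a (node l r) =
  χ a (size (node l r)) ≡ false × Avoids χ a l × Avoids χ (suc (a + size l)) r

-- The fuel only ensures termination: the list is complete as soon as p ≤ fuel.
shapes′ : Forbidden → (fuel a p : ℕ) → List Shape
splits : Forbidden → (fuel a p s : ℕ) → List Shape

shapes′ χ _       a zero    = [ leaf ]
shapes′ χ zero    a (suc p) = []
shapes′ χ (suc f) a (suc p) =
  if χ a (suc p) then []
  else concat (applyUpTo (splits χ f a p) (suc p))

splits χ f a p s = cartesianProductWith node (shapes′ χ f a s) (shapes′ χ f (suc (a + s)) (p ∸ s))

shapes : Forbidden → (a p : ℕ) → List Shape
shapes χ a p = shapes′ χ p a p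

∈-shapes′⁺ : ∀ χ f a t → size t ≤ f → Avoids χ a t → t List.∈ shapes′ χ f a (size t)
∈-shapes′⁺ χ f a leaf _ _ = here refl
∈-shapes′⁺ χ (suc f) a (node l r) (s≤s le) (χ≡ , al , ar) rewrite χ≡ =
  ∈-concat⁺′ (∈-cartesianProductWith⁺ node
                (∈-shapes′⁺ χ f a l (m+n≤o⇒m≤o (size l) le) al)
                (subst (λ k → r List.∈ shapes′ χ f (suc (a + size l)) k) (sym (m+n∸m≡n (size l) (size r)))
                       (∈-shapes′⁺ χ f (suc (a + size l)) r (m+n≤o⇒n≤o (size l) le) ar)))
             (∈-applyUpTo⁺ (splits χ f a (size l + size r)) (s≤s (m≤m+n (size l) (size r))))

∈-shapes′⁻ : ∀ χ f a p {t} → t List.∈ shapes′ χ f a p → size t ≡ p × Avoids χ a t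
∈-shapes′⁻ χ f       a zero    (here refl) = refl , tt
∈-shapes′⁻ χ (suc f) a (suc p) t∈ with χ a (suc p) in χ≡
... | false with _ , t∈xs , xs∈ ← ∈-concat⁻′ (applyUpTo (splits χ f a p) (suc p)) t∈
            with s , s≤s s≤p , refl ← ∈-applyUpTo⁻ (splits χ f a p) xs∈
            with l , r , l∈ , r∈ , refl ← ∈-cartesianProductWith⁻ node (shapes′ χ f a s) _ t∈xs
            with refl , al ← ∈-shapes′⁻ χ f a s l∈
            with sr≡ , ar ← ∈-shapes′⁻ χ f (suc (a + s)) (p ∸ s) r∈ =
  cong suc size≡ , trans (cong (λ k → χ a (suc k)) size≡) χ≡ , al , ar
  where
  size≡ : size l + size r ≡ p
  size≡ = trans (cong (size l +_) sr≡) (m+[n∸m]≡n s≤p)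

shapes′-unique : ∀ χ f a p → Unique (shapes′ χ f a p)
shapes′-unique χ f       a zero    = [] ∷ []
shapes′-unique χ zero    a (suc p) = []
shapes′-unique χ (suc f) a (suc p) with χ a (suc p)
... | true  = []
... | false = Unique.concat⁺
  (All.applyUpTo⁺₂ (splits χ f a p) (suc p) λ s → Unique.cartesianProductWith⁺ node (λ { refl → refl , refl })
     (shapes′-unique χ f a s) (shapes′-unique χ f (suc (a + s)) (p ∸ s)))
  (AllPairs.applyUpTo⁺₁ (splits χ f a p) (suc p) λ {i} {j} i<j _ (∈i , ∈j) →
     <⇒≢ i<j (sizes i j ∈i ∈j))
  where
  sizes : ∀ i j {t} → t List.∈ splits χ f a p i → t List.∈ splits χ f a p j → i ≡ j
  sizes i j ∈i ∈j
    with l , r , l∈ , _ , refl ← ∈-cartesianProductWith⁻ node (shapes′ χ f a i) _ ∈i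
    with _ , _ , l∈′ , _ , refl ← ∈-cartesianProductWith⁻ node (shapes′ χ f a j) _ ∈j =
    trans (sym (proj₁ (∈-shapes′⁻ χ f a i l∈))) (proj₁ (∈-shapes′⁻ χ f a j l∈′))

length-cartesianProductWith : ∀ {A B C : Set} (f : A → B → C) xs ys →
  length (cartesianProductWith f xs ys) ≡ length xs * length ys
length-cartesianProductWith f []       ys = refl
length-cartesianProductWith f (x ∷ xs) ys =
  trans (length-++ (map (f x) ys))
        (cong₂ _+_ (length-map (f x) ys) (length-cartesianProductWith f xs ys))

length-concat-applyUpTo : ∀ {A : Set} (F : ℕ → List A) n →
  length (concat (applyUpTo F n)) ≡ ∑ n (length ∘ F)
length-concat-applyUpTo F zero    = refl
length-concat-applyUpTo F (suc n) =
  trans (length-++ (F 0)) (cong (length (F 0) +_) (length-concat-applyUpTo (F ∘ suc) n))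

count′ : Forbidden → (fuel a p : ℕ) → ℕ
count′ χ f a p = length (shapes′ χ f a p)

count : Forbidden → (a p : ℕ) → ℕ
count χ a p = length (shapes χ a p)

count′-suc : ∀ χ f a p → count′ χ (suc f) a (suc p) ≡
  (if χ a (suc p) then 0 else ∑ (suc p) (λ s → count′ χ f a s * count′ χ f (suc (a + s)) (p ∸ s)))
count′-suc χ f a p with χ a (suc p)
... | true  = refl
... | false = trans (length-concat-applyUpTo (splits χ f a p) (suc p))
                    (∑-cong (suc p) λ s _ → length-cartesianProductWith node (shapes′ χ f a s)
                                            (shapes′ χ f (suc (a + s)) (p ∸ s)))

-- Two facts share one induction: surplus fuel does not change the count, and the count sees only
-- the forbidden segments inside the polygon, up to a shift of the labels.
count′-cong : ∀ χ χ′ f f′ a a′ p → p ≤ f → p ≤ f′ →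
  (∀ x s → x + suc s ≤ p → χ (a + x) (suc s) ≡ χ′ (a′ + x) (suc s)) →
  count′ χ f a p ≡ count′ χ′ f′ a′ p
count′-cong χ χ′ f f′ a a′ zero _ _ _ = refl
count′-cong χ χ′ (suc f) (suc f′) a a′ (suc p) (s≤s p≤f) (s≤s p≤f′) eq =
  trans (count′-suc χ f a p)
    (trans (cong₂ (λ b m → if b then 0 else m) root sums) (sym (count′-suc χ′ f′ a′ p)))
  where
  root : χ a (suc p) ≡ χ′ a′ (suc p)
  root = subst₂ (λ i i′ → χ i (suc p) ≡ χ′ i′ (suc p)) (+-identityʳ a) (+-identityʳ a′) (eq 0 p ≤-refl)
  shift : ∀ a s x → a + (suc s + x) ≡ suc (a + s) + x
  shift = solve-∀
  sums = ∑-cong (suc p) λ { s (s≤s s≤p) → cong₂ _*_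
    (count′-cong χ χ′ f f′ a a′ s (≤-trans s≤p p≤f) (≤-trans s≤p p≤f′)
      λ x k le → eq x k (≤-trans le (m≤n⇒m≤1+n s≤p)))
    (count′-cong χ χ′ f f′ (suc (a + s)) (suc (a′ + s)) (p ∸ s)
      (≤-trans (m∸n≤m p s) p≤f) (≤-trans (m∸n≤m p s) p≤f′)
      λ x k le → subst₂ (λ i i′ → χ i (suc k) ≡ χ′ i′ (suc k)) (shift a s x) (shift a′ s x)
        (eq (suc s + x) k (s≤s (subst (_≤ p) (sym (+-assoc s x (suc k)))
          (subst (s + (x + suc k) ≤_) (m+[n∸m]≡n s≤p) (+-monoʳ-≤ s le)))))) }

count-cong : ∀ {χ χ′ a a′} p → (∀ x s → x + suc s ≤ p → χ (a + x) (suc s) ≡ χ′ (a′ + x) (suc s)) →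
  count χ a p ≡ count χ′ a′ p
count-cong {χ} {χ′} {a} {a′} p eq = count′-cong χ χ′ p p a a′ p ≤-refl ≤-refl eq

count-suc : ∀ χ a p → count χ a (suc p) ≡
  (if χ a (suc p) then 0 else ∑ (suc p) (λ s → count χ a s * count χ (suc (a + s)) (p ∸ s)))
count-suc χ a p = trans (count′-suc χ p a p)
  (cong (if χ a (suc p) then 0 else_) (∑-cong (suc p) λ { s (s≤s s≤p) → cong₂ _*_
    (count′-cong χ χ p s a a s s≤p ≤-refl λ _ _ _ → refl)
    (count′-cong χ χ p (p ∸ s) (suc (a + s)) (suc (a + s)) (p ∸ s) (m∸n≤m p s) ≤-refl λ _ _ _ → refl) }))

count-forbidden : ∀ χ a p → χ a (suc p) ≡ true → count χ a (suc p) ≡ 0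
count-forbidden χ a p χ≡ rewrite count-suc χ a p | χ≡ = refl

count-allowed : ∀ χ a p → χ a (suc p) ≡ false →
  count χ a (suc p) ≡ ∑ (suc p) (λ s → count χ a s * count χ (suc (a + s)) (p ∸ s))
count-allowed χ a p χ≡ rewrite count-suc χ a p | χ≡ = refl

∅ : Forbidden
∅ _ _ = false

_∪_ : Forbidden → Forbidden → Forbidden
(χ ∪ χ′) i s = χ i s ∨ χ′ i s

cat : ℕ → ℕ
cat = count ∅ 0

count-∅ : ∀ {χ} a p → (∀ x s → x + suc s ≤ p → χ (a + x) (suc s) ≡ false) → count χ a p ≡ cat p
count-∅ a p eq = count-cong p eq

cat-suc : ∀ p → cat (suc p) ≡ conv cat cat p
cat-suc p = trans (count-suc ∅ 0 p)
  (∑-cong (suc p) λ s _ → cong (cat s *_) (count-∅ {∅} (suc s) (p ∸ s) λ _ _ _ → refl))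

open SelfConvolution cat refl cat-suc public using () renaming (≡catalan to cat≡catalan)

⟪_,_⟫ : ℕ → ℕ → Forbidden
⟪ e , l ⟫ i s = (i ≡ᵇ e) ∧ (s ≡ᵇ l)

⟪⟫⇒≡ : ∀ e l i s → ⟪ e , l ⟫ i s ≡ true → i ≡ e × s ≡ l
⟪⟫⇒≡ e l i s eq with i ≡ᵇ e in i≡e | s ≡ᵇ l in s≡l
... | true | true = ≡ᵇ⇒≡ i e (Equivalence.from T-≡ i≡e) , ≡ᵇ⇒≡ s l (Equivalence.from T-≡ s≡l)

⟪⟫-refl : ∀ e l → ⟪ e , l ⟫ e l ≡ true
⟪⟫-refl e l rewrite Equivalence.to T-≡ (≡⇒≡ᵇ e e refl) | Equivalence.to T-≡ (≡⇒≡ᵇ l l refl) = refl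

difference : ∀ {m n} → m < n → Σ[ d ∈ ℕ ] n ≡ suc m + d
difference {m} {n} m<n = n ∸ suc m , sym (m+[n∸m]≡n m<n)

-- Naming the remainder d turns truncated subtraction into addition, where ring identities apply.
∑-cong-difference : ∀ n {f g : ℕ → ℕ} → (∀ i d → n ≡ suc i + d → f i ≡ g i) → ∑ n f ≡ ∑ n g
∑-cong-difference n eq = ∑-cong n λ i i<n → let d , n≡ = difference i<n in eq i d n≡

-- χ′ is χ seen after contracting the segment with l + 1 inner nodes on the vertices
-- e, …, e + l + 2 to a side, which lowers the labels beyond it by l + 1.
module Contraction (χ χ′ : Forbidden) (e l : ℕ)
  (around : ∀ a x y → a + x ≡ e → 0 < x + y → χ a (suc (x + l + y)) ≡ χ′ a (x + y))
  (before : ∀ i s → i + s < e → χ i s ≡ χ′ i s)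
  (after  : ∀ i s → e < i → χ (i + suc l) s ≡ χ′ i s)
  where

  χ⁺ : Forbidden
  χ⁺ = χ ∪ ⟪ e , suc l ⟫

  -- The polygon a, ..., a + p + 1 starts beyond e or stops short of e + l + 2, so the newly
  -- forbidden segment does not fit into it.
  count-outside : ∀ a p → (e < a ⊎ a + p < e + suc l) → count χ a p ≡ count χ⁺ a p
  count-outside a p out = count-cong p λ x s le →
    sym (trans (cong (χ (a + x) (suc s) ∨_) (¬-not (λ eq → lies out x s le (⟪⟫⇒≡ e (suc l) _ _ eq)))) (∨-identityʳ _))
    where
    lies : (e < a ⊎ a + p < e + suc l) → ∀ x s → x + suc s ≤ p → ¬ (a + x ≡ e × suc s ≡ suc l)
    lies (inj₁ e<a) x s le (refl , _) = <⇒≱ e<a (m≤m+n a x)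
    lies (inj₂ lt) x s le (refl , refl) =
      <⇒≱ lt (subst (_≤ a + p) (sym (+-assoc a x (suc s))) (+-monoʳ-≤ a le))

  count-before : ∀ a p → a + p < e → count χ a p ≡ count χ′ a p
  count-before a p lt = count-cong p λ x s le →
    before (a + x) (suc s) (≤-<-trans (subst (_≤ a + p) (sym (+-assoc a x (suc s))) (+-monoʳ-≤ a le)) lt)

  count-after : ∀ a p → e < a → count χ (a + suc l) p ≡ count χ′ a p
  count-after a p e<a = count-cong p λ x s le →
    trans (cong (λ i → χ i (suc s)) (swap a (suc l) x)) (after (a + x) (suc s) (<-≤-trans e<a (m≤m+n a x)))
    where
    swap : ∀ a b c → a + b + c ≡ a + c + b
    swap = solve-∀

  Contracts : ℕ → ℕ → ℕ → Set
  Contracts a x y = count χ a (suc (x + l + y)) ≡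
    count χ⁺ a (suc (x + l + y)) + count χ e (suc l) * count χ′ a (x + y)

  -- Here the segment is the whole base: forbidding it leaves no tree, and the contracted polygon is
  -- a single side.
  contracts-self : Contracts e 0 0
  contracts-self rewrite +-identityʳ l = sym (begin
    count χ⁺ e (suc l) + count χ e (suc l) * 1
      ≡⟨ cong₂ _+_ (count-forbidden χ⁺ e l (trans (cong (χ e (suc l) ∨_) (⟪⟫-refl e (suc l))) (∨-zeroʳ _)))
                   (*-identityʳ (count χ e (suc l))) ⟩
    count χ e (suc l) ∎)
    where open ≡-Reasoning

  -- Compare the trees by the apex a + s + 1 of the root. For s < x (`low`) the segment lies in the
  -- right child polygon, for s > x + l (`high`) in the left one, and induction applies there. In
  -- between (`middle`) the apex is strictly inside the segment, neither child polygon contains it,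
  -- and no tree is lost. The outer two ranges together run over the apexes of the contracted
  -- polygon. If the root is forbidden, everything vanishes.
  contracts-step : ∀ a x y q → x + y ≡ suc q → a + x ≡ e →
    (∀ a′ x′ y′ → x′ + y′ < x + y → a′ + x′ ≡ e → Contracts a′ x′ y′) → Contracts a x y
  contracts-step a x y q x+y≡ refl ih = helper (χ a (suc P)) refl
    where
    open ≡-Reasoning
    P = x + l + y
    K = count χ e (suc l)
    F = λ s → count χ a s * count χ (suc (a + s)) (P ∸ s)
    G = λ s → count χ⁺ a s * count χ⁺ (suc (a + s)) (P ∸ s)
    H = λ s → count χ′ a s * count χ′ (suc (a + s)) (q ∸ s)

    root : χ⁺ a (suc P) ≡ χ a (suc P)
    root = trans (cong (χ a (suc P) ∨_) (¬-not λ eq → not-self (⟪⟫⇒≡ e (suc l) a (suc P) eq))) (∨-identityʳ _)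
      where
      not-self : ¬ (a ≡ a + x × suc P ≡ suc l)
      not-self (a≡ , P≡) = 1+n≢0 (trans (sym x+y≡) (cong₂ _+_ x≡0 y≡0))
        where
        x≡0 : x ≡ 0
        x≡0 = +-cancelˡ-≡ a x 0 (trans (sym a≡) (sym (+-identityʳ a)))
        y≡0 : y ≡ 0
        y≡0 = +-cancelˡ-≡ l y 0 (trans (cong (λ k → k + l + y) (sym x≡0)) (trans (suc-injective P≡) (sym (+-identityʳ l))))

    root′ : χ′ a (suc q) ≡ χ a (suc P)
    root′ = trans (cong (χ′ a) (sym x+y≡))
      (sym (around a x y refl (subst (0 <_) (sym x+y≡) (s≤s z≤n))))

    low : ∀ s d → x ≡ suc s + d → F s ≡ G s + K * H s
    low s d x≡ = begin
      count χ a s * count χ (suc (a + s)) (P ∸ s)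
        ≡⟨ cong (λ k → count χ a s * count χ (suc (a + s)) k) P∸s ⟩
      count χ a s * count χ (suc (a + s)) (suc (d + l + y))
        ≡⟨ cong₂ _*_ (count-outside a s (inj₂ (<-≤-trans a+s<e (m≤m+n e (suc l)))))
             (ih (suc (a + s)) d y smaller e≡) ⟩
      count χ⁺ a s * (count χ⁺ (suc (a + s)) (suc (d + l + y)) + K * count χ′ (suc (a + s)) (d + y))
        ≡⟨ distribute (count χ⁺ a s) _ K _ ⟩
      count χ⁺ a s * count χ⁺ (suc (a + s)) (suc (d + l + y)) + K * (count χ⁺ a s * count χ′ (suc (a + s)) (d + y))
        ≡⟨ cong₂ (λ j k → count χ⁺ a s * count χ⁺ (suc (a + s)) j + K * (count χ⁺ a s * count χ′ (suc (a + s)) k)) P∸s q∸s ⟨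
      count χ⁺ a s * count χ⁺ (suc (a + s)) (P ∸ s) + K * (count χ⁺ a s * count χ′ (suc (a + s)) (q ∸ s))
        ≡⟨ cong (λ k → G s + K * (k * count χ′ (suc (a + s)) (q ∸ s)))
             (trans (sym (count-outside a s (inj₂ (<-≤-trans a+s<e (m≤m+n e (suc l)))))) (count-before a s a+s<e)) ⟩
      G s + K * H s ∎
      where
      distribute : ∀ u v k w → u * (v + k * w) ≡ u * v + k * (u * w)
      distribute = solve-∀
      rearrange₁ : ∀ s d l y → suc s + d + l + y ≡ s + suc (d + l + y)
      rearrange₁ = solve-∀
      rearrange₂ : ∀ a s d → suc (a + s) + d ≡ a + (suc s + d)
      rearrange₂ = solve-∀
      P∸s : P ∸ s ≡ suc (d + l + y)
      P∸s = trans (cong (_∸ s) (trans (cong (λ x → x + l + y) x≡) (rearrange₁ s d l y))) (m+n∸m≡n s _)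
      q∸s : q ∸ s ≡ d + y
      q∸s = trans (cong (_∸ s) (suc-injective (trans (sym x+y≡) (trans (cong (_+ y) x≡) (+-assoc (suc s) d y))))) (m+n∸m≡n s _)
      a+s<e : a + s < a + x
      a+s<e = +-monoʳ-< a (subst (s <_) (sym x≡) (s≤s (m≤m+n s d)))
      smaller : d + y < x + y
      smaller = +-monoˡ-< y (subst (d <_) (sym x≡) (s≤s (m≤n+m d s)))
      e≡ : suc (a + s) + d ≡ a + x
      e≡ = trans (rearrange₂ a s d) (cong (a +_) (sym x≡))

    middle : ∀ i → i < suc l → F (x + i) ≡ G (x + i)
    middle i i<1+l = cong₂ _*_
      (count-outside a (x + i) (inj₂ (subst (_< e + suc l) (+-assoc a x i) (+-monoʳ-< e i<1+l))))
      (count-outside (suc (a + (x + i))) (P ∸ (x + i)) (inj₁ (s≤s (+-monoʳ-≤ a (m≤m+n x i)))))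

    high : ∀ i d → y ≡ suc i + d → F (x + (suc l + i)) ≡ G (x + (suc l + i)) + K * H (x + i)
    high i d y≡ = begin
      count χ a s * count χ (suc (a + s)) (P ∸ s)
        ≡⟨ cong₂ (λ j k → count χ a j * k) s≡ (count-outside (suc (a + s)) (P ∸ s) (inj₁ e<)) ⟩
      count χ a (suc (x + l + i)) * count χ⁺ (suc (a + s)) (P ∸ s)
        ≡⟨ cong (_* count χ⁺ (suc (a + s)) (P ∸ s)) (ih a x i (+-monoʳ-< x (subst (i <_) (sym y≡) (s≤s (m≤m+n i d)))) refl) ⟩
      (count χ⁺ a (suc (x + l + i)) + K * count χ′ a (x + i)) * count χ⁺ (suc (a + s)) (P ∸ s)
        ≡⟨ distribute (count χ⁺ a (suc (x + l + i))) K (count χ′ a (x + i)) (count χ⁺ (suc (a + s)) (P ∸ s)) ⟩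
      count χ⁺ a (suc (x + l + i)) * count χ⁺ (suc (a + s)) (P ∸ s) + K * (count χ′ a (x + i) * count χ⁺ (suc (a + s)) (P ∸ s))
        ≡⟨ cong₂ (λ j k → count χ⁺ a j * count χ⁺ (suc (a + s)) (P ∸ s) + K * (count χ′ a (x + i) * k)) (sym s≡) after≡ ⟩
      G s + K * H (x + i) ∎
      where
      s = x + (suc l + i)
      distribute : ∀ u k v w → (u + k * v) * w ≡ u * w + k * (v * w)
      distribute = solve-∀
      rearrange₁ : ∀ x l i → x + (suc l + i) ≡ suc (x + l + i)
      rearrange₁ = solve-∀
      rearrange₂ : ∀ x l i d → x + l + (suc i + d) ≡ x + (suc l + i) + d
      rearrange₂ = solve-∀
      rearrange₃ : ∀ x i d → x + (suc i + d) ≡ suc (x + i + d)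
      rearrange₃ = solve-∀
      rearrange₄ : ∀ a x l i → suc (a + (x + (suc l + i))) ≡ suc (a + (x + i)) + suc l
      rearrange₄ = solve-∀
      s≡ : s ≡ suc (x + l + i)
      s≡ = rearrange₁ x l i
      e< : a + x < suc (a + s)
      e< = s≤s (+-monoʳ-≤ a (m≤m+n x (suc l + i)))
      P∸s : P ∸ s ≡ d
      P∸s = trans (cong (_∸ s) (trans (cong (x + l +_) y≡) (rearrange₂ x l i d))) (m+n∸m≡n s d)
      q∸ : q ∸ (x + i) ≡ d
      q∸ = trans (cong (_∸ (x + i)) (suc-injective (trans (sym x+y≡) (trans (cong (x +_) y≡) (rearrange₃ x i d))))) (m+n∸m≡n (x + i) d)
      after≡ : count χ⁺ (suc (a + s)) (P ∸ s) ≡ count χ′ (suc (a + (x + i))) (q ∸ (x + i))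
      after≡ = begin
        count χ⁺ (suc (a + s)) (P ∸ s)             ≡⟨ count-outside (suc (a + s)) (P ∸ s) (inj₁ e<) ⟨
        count χ (suc (a + s)) (P ∸ s)              ≡⟨ cong₂ (count χ) (rearrange₄ a x l i) (trans P∸s (sym q∸)) ⟩
        count χ (suc (a + (x + i)) + suc l) (q ∸ (x + i)) ≡⟨ count-after (suc (a + (x + i))) (q ∸ (x + i)) (s≤s (+-monoʳ-≤ a (m≤m+n x i))) ⟩
        count χ′ (suc (a + (x + i))) (q ∸ (x + i)) ∎

    split : ∀ (f : ℕ → ℕ) → ∑ (suc P) f ≡
      ∑ x f + (∑ (suc l) (λ i → f (x + i)) + ∑ y (λ i → f (x + (suc l + i))))
    split f = begin
      ∑ (suc P) f          ≡⟨ cong (λ k → ∑ k f) (rearrange x l y) ⟩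
      ∑ (x + (suc l + y)) f ≡⟨ ∑-split x (suc l + y) f ⟩
      ∑ x f + ∑ (suc l + y) (λ i → f (x + i)) ≡⟨ cong (∑ x f +_) (∑-split (suc l) y (λ i → f (x + i))) ⟩
      ∑ x f + (∑ (suc l) (λ i → f (x + i)) + ∑ y (λ i → f (x + (suc l + i)))) ∎
      where
      rearrange : ∀ x l y → suc (x + l + y) ≡ x + (suc l + y)
      rearrange = solve-∀

    pull : ∀ n (f g : ℕ → ℕ) → ∑ n (λ i → f i + K * g i) ≡ ∑ n f + K * ∑ n g
    pull n f g = trans (∑-distrib-+ n f (λ i → K * g i)) (cong (∑ n f +_) (∑-distribˡ-* n K g))

    sums : ∑ (suc P) F ≡ ∑ (suc P) G + K * ∑ (suc q) H
    sums = begin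
      ∑ (suc P) F
        ≡⟨ split F ⟩
      ∑ x F + (∑ (suc l) (λ i → F (x + i)) + ∑ y (λ i → F (x + (suc l + i))))
        ≡⟨ cong₂ _+_ (trans (∑-cong-difference x low) (pull x G H))
             (cong₂ _+_ (∑-cong (suc l) middle)
               (trans (∑-cong-difference y high) (pull y (λ i → G (x + (suc l + i))) (λ i → H (x + i))))) ⟩
      (∑ x G + K * ∑ x H) + (∑ (suc l) (λ i → G (x + i)) + (∑ y (λ i → G (x + (suc l + i))) + K * ∑ y (λ i → H (x + i))))
        ≡⟨ regroup (∑ x G) K (∑ x H) (∑ (suc l) (λ i → G (x + i))) (∑ y (λ i → G (x + (suc l + i)))) (∑ y (λ i → H (x + i))) ⟩
      (∑ x G + (∑ (suc l) (λ i → G (x + i)) + ∑ y (λ i → G (x + (suc l + i))))) + K * (∑ x H + ∑ y (λ i → H (x + i)))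
        ≡⟨ cong₂ (λ u v → u + K * v) (split G) (∑-split x y H) ⟨
      ∑ (suc P) G + K * ∑ (x + y) H
        ≡⟨ cong (λ n → ∑ (suc P) G + K * ∑ n H) x+y≡ ⟩
      ∑ (suc P) G + K * ∑ (suc q) H ∎
      where
      regroup : ∀ a k b c d e → (a + k * b) + (c + (d + k * e)) ≡ (a + (c + d)) + k * (b + e)
      regroup = solve-∀

    helper : ∀ b → χ a (suc P) ≡ b → Contracts a x y
    helper true χ≡ = begin
      count χ a (suc P)
        ≡⟨ count-forbidden χ a P χ≡ ⟩
      0
        ≡⟨ *-zeroʳ K ⟨
      0 + K * 0
        ≡⟨ cong₂ (λ u v → u + K * v) (count-forbidden χ⁺ a P (trans root χ≡))
             (trans (cong (count χ′ a) x+y≡) (count-forbidden χ′ a q (trans root′ χ≡))) ⟨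
      count χ⁺ a (suc P) + K * count χ′ a (x + y) ∎
    helper false χ≡ = begin
      count χ a (suc P)
        ≡⟨ count-allowed χ a P χ≡ ⟩
      ∑ (suc P) F
        ≡⟨ sums ⟩
      ∑ (suc P) G + K * ∑ (suc q) H
        ≡⟨ cong₂ (λ u v → u + K * v) (count-allowed χ⁺ a P (trans root χ≡))
             (trans (cong (count χ′ a) x+y≡) (count-allowed χ′ a q (trans root′ χ≡))) ⟨
      count χ⁺ a (suc P) + K * count χ′ a (x + y) ∎

  contraction : ∀ a x y → a + x ≡ e → Contracts a x y
  contraction a x y a+x≡e = below (suc (x + y)) a x y ≤-refl a+x≡e
    where
    below : ∀ f a x y → x + y < f → a + x ≡ e → Contracts a x y
    below (suc f) a zero    zero    _        a≡e with refl ← trans (sym (+-identityʳ a)) a≡e = contracts-self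
    below (suc f) a zero    (suc y) (s≤s le) eq =
      contracts-step a zero (suc y) y refl eq λ a′ x′ y′ lt → below f a′ x′ y′ (<-≤-trans lt le)
    below (suc f) a (suc x) y       (s≤s le) eq =
      contracts-step a (suc x) y (x + y) refl eq λ a′ x′ y′ lt → below f a′ x′ y′ (<-≤-trans lt le)

-- Forbidding the nodes of a chain

data Chain : Shape → Set where
  leaf   : Chain leaf
  growˡ : ∀ {t} → Chain t → Chain (node leaf t)
  growʳ : ∀ {t} → Chain t → Chain (node t leaf)

nodes : ℕ → Shape → Forbidden
nodes a leaf       = ∅
nodes a (node l r) = ⟪ a , size (node l r) ⟫ ∪ (nodes a l ∪ nodes (suc (a + size l)) r)

∨-true : ∀ x y → x ∨ y ≡ true → x ≡ true ⊎ y ≡ true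
∨-true true  y _ = inj₁ refl
∨-true false y p = inj₂ p

nodes-bounds : ∀ a t i s → nodes a t i s ≡ true → a ≤ i × i + s ≤ a + size t × 1 ≤ s
nodes-bounds a (node l r) i s eq with ∨-true _ _ eq
... | inj₁ top with refl , refl ← ⟪⟫⇒≡ a _ i s top = ≤-refl , ≤-refl , s≤s z≤n
... | inj₂ below with ∨-true _ _ below
...   | inj₁ inl with a≤i , i+s≤ , 1≤s ← nodes-bounds a l i s inl =
  a≤i , ≤-trans i+s≤ (+-monoʳ-≤ a (m≤n⇒m≤1+n (m≤m+n (size l) (size r)))) , 1≤s
...   | inj₂ inr with a≤i , i+s≤ , 1≤s ← nodes-bounds (suc (a + size l)) r i s inr =
  ≤-trans (m≤n⇒m≤1+n (m≤m+n a (size l))) a≤i ,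
  ≤-trans i+s≤ (≤-reflexive (rearrange a (size l) (size r))) , 1≤s
  where
  rearrange : ∀ a x y → suc (a + x) + y ≡ a + suc (x + y)
  rearrange = solve-∀

-- The entry i, s is the segment ending at i + s + 1, so the forbidden segments end at e at the
-- latest and share at most the vertex e with a chain starting there.
LeftOf : ℕ → Forbidden → Set
LeftOf e ψ = ∀ i s → e ≤ i + s → ψ i s ≡ false

-- The step of the induction on chains, common to both directions of growth: `N` holds the k inner
-- nodes, already forbidden, and the segment of size k + 1 starting at e is the next to go.
module _ (ψ N : Forbidden) (e k : ℕ) (ψ-left : LeftOf e ψ)
  (N-bounds : ∀ i s → N i s ≡ true → e ≤ i × i + s ≤ e + suc k × s ≤ k)
  (ih : ∀ a x y → a + x ≡ e → count ψ a (suc (x + k + y)) ≡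
    count (ψ ∪ N) a (suc (x + k + y)) + ∑ k (λ i → cat i * count ψ a (x + y + (k ∸ i))))
  where

  private
    χ = ψ ∪ N

    -- A segment around the new one has size above k, hence is no node of `N`, and it ends beyond e,
    -- hence is not in `ψ`.
    around : ∀ a x y → a + x ≡ e → 0 < x + y → χ a (suc (x + k + y)) ≡ ψ a (x + y)
    around a x y refl _ = trans
      (cong₂ _∨_ (ψ-left a _ (+-monoʳ-≤ a (m≤n⇒m≤1+n (≤-trans (m≤m+n x k) (m≤m+n (x + k) y)))))
                 (¬-not λ eq → <⇒≱ (s≤s (≤-trans (m≤n+m k x) (m≤m+n (x + k) y))) (proj₂ (proj₂ (N-bounds a _ eq)))))
      (sym (ψ-left a (x + y) (+-monoʳ-≤ a (m≤m+n x y))))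

    before : ∀ i s → i + s < e → χ i s ≡ ψ i s
    before i s lt = trans (cong (ψ i s ∨_) (¬-not λ eq → <⇒≱ lt (≤-trans (proj₁ (N-bounds i s eq)) (m≤m+n i s)))) (∨-identityʳ _)

    after : ∀ i s → e < i → χ (i + suc k) s ≡ ψ i s
    after i s lt = trans
      (cong₂ _∨_ (ψ-left (i + suc k) s (≤-trans e≤i (≤-trans (m≤m+n i (suc k)) (m≤m+n _ s))))
                 (¬-not λ eq → <⇒≱ (+-monoˡ-< (suc k) lt) (≤-trans (m≤m+n _ s) (proj₁ (proj₂ (N-bounds _ s eq))))))
      (sym (ψ-left i s (≤-trans e≤i (m≤m+n i s))))
      where
      e≤i : e ≤ i
      e≤i = <⇒≤ lt

    open Contraction χ ψ e k around before after

    -- Take x = y = 0 in `ih`, so that the polygon is the new segment itself, where `ψ` forbids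
    -- nothing. The terms subtracted from c(k + 1) are those with i < k of its recurrence; the term
    -- c(k) c(0) remains.
    count-top : count χ e (suc k) ≡ cat k
    count-top = +-cancelʳ-≡ (∑ k (λ i → cat i * cat (k ∸ i))) _ _ (begin
      count χ e (suc k) + ∑ k (λ i → cat i * cat (k ∸ i))
        ≡⟨ cong₂ _+_ (cong (λ j → count χ e (suc j)) (+-identityʳ k))
             (∑-cong k λ i _ → cong (cat i *_) (free (k ∸ i))) ⟨
      count χ e (suc (k + 0)) + ∑ k (λ i → cat i * count ψ e (k ∸ i))
        ≡⟨ ih e 0 0 (+-identityʳ e) ⟨
      count ψ e (suc (k + 0))
        ≡⟨ trans (free (suc (k + 0))) (cong (cat ∘ suc) (+-identityʳ k)) ⟩
      cat (suc k)
        ≡⟨ trans (cat-suc k) (∑-suc k (λ i → cat i * cat (k ∸ i))) ⟩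
      ∑ k (λ i → cat i * cat (k ∸ i)) + cat k * cat (k ∸ k)
        ≡⟨ cong (∑ k (λ i → cat i * cat (k ∸ i)) +_) (trans (cong (λ j → cat k * cat j) (n∸n≡0 k)) (*-identityʳ (cat k))) ⟩
      ∑ k (λ i → cat i * cat (k ∸ i)) + cat k
        ≡⟨ +-comm _ (cat k) ⟩
      cat k + ∑ k (λ i → cat i * cat (k ∸ i)) ∎)
      where
      open ≡-Reasoning
      free : ∀ p → count ψ e p ≡ cat p
      free p = count-∅ e p λ x s _ → ψ-left (e + x) (suc s) (≤-trans (m≤m+n e x) (m≤m+n (e + x) (suc s)))

  -- Contracting the new segment removes c(k) times the count for x + y, which is the term i = k
  -- that completes the partial sum of `ih` to a convolution.
  grow : ∀ a x y → a + x ≡ e → count ψ a (suc (x + k + y)) ≡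
    count χ⁺ a (suc (x + k + y)) + conv cat (λ j → count ψ a (x + y + j)) k
  grow a x y a+x≡e = begin
    count ψ a (suc (x + k + y))
      ≡⟨ ih a x y a+x≡e ⟩
    count χ a (suc (x + k + y)) + S
      ≡⟨ cong (_+ S) (contraction a x y a+x≡e) ⟩
    count χ⁺ a (suc (x + k + y)) + count χ e (suc k) * count ψ a (x + y) + S
      ≡⟨ cong₂ (λ u v → count χ⁺ a (suc (x + k + y)) + u * count ψ a v + S) count-top
           (trans (sym (+-identityʳ (x + y))) (cong (x + y +_) (sym (n∸n≡0 k)))) ⟩
    count χ⁺ a (suc (x + k + y)) + cat k * count ψ a (x + y + (k ∸ k)) + S
      ≡⟨ trans (+-assoc (count χ⁺ a (suc (x + k + y))) _ S) (cong (count χ⁺ a (suc (x + k + y)) +_) (+-comm _ S)) ⟩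
    count χ⁺ a (suc (x + k + y)) + (S + cat k * count ψ a (x + y + (k ∸ k)))
      ≡⟨ cong (count χ⁺ a (suc (x + k + y)) +_) (∑-suc k (λ i → cat i * count ψ a (x + y + (k ∸ i)))) ⟨
    count χ⁺ a (suc (x + k + y)) + conv cat (λ j → count ψ a (x + y + j)) k ∎
    where
    open ≡-Reasoning
    S = ∑ k (λ i → cat i * count ψ a (x + y + (k ∸ i)))

-- The term i belongs to the node of size i + 1: c(i) trees sit on it, and contracting it lowers the
-- size of the polygon by i + 1. The right side depends on the size of the chain but not on its
-- turns.
count-chain : ∀ {t} → Chain t → ∀ ψ e → LeftOf e ψ → ∀ a x y → a + x ≡ e →
  count ψ a (x + size t + y) ≡ count (ψ ∪ nodes e t) a (x + size t + y) +
    ∑ (size t) (λ i → cat i * count ψ a (x + y + (size t ∸ suc i)))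
count-chain leaf ψ e _ a x y _ = trans
  (count-cong {ψ} {ψ ∪ ∅} {a} {a} (x + 0 + y) λ z s _ → sym (∨-identityʳ (ψ (a + z) (suc s))))
  (sym (+-identityʳ _))
count-chain (growˡ {t} c) ψ e ψ-left a x y a+x≡e = begin
  count ψ a (x + suc k + y)
    ≡⟨ cong (λ j → count ψ a (j + y)) (+-suc x k) ⟩
  count ψ a (suc (x + k + y))
    ≡⟨ grow ψ (nodes e′ t) e k ψ-left bounds ih a x y a+x≡e ⟩
  count ((ψ ∪ nodes e′ t) ∪ ⟪ e , suc k ⟫) a (suc (x + k + y)) + conv cat (λ j → count ψ a (x + y + j)) k
    ≡⟨ cong (_+ conv cat (λ j → count ψ a (x + y + j)) k) (trans
         (count-cong {(ψ ∪ nodes e′ t) ∪ ⟪ e , suc k ⟫} {ψ ∪ nodes e (node leaf t)} {a} {a} (suc (x + k + y)) λ z s _ →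
           shuffle (ψ (a + z) (suc s)) (nodes e′ t (a + z) (suc s)) (⟪ e , suc k ⟫ (a + z) (suc s)))
         (cong (λ j → count (ψ ∪ nodes e (node leaf t)) a (j + y)) (sym (+-suc x k)))) ⟩
  count (ψ ∪ nodes e (node leaf t)) a (x + suc k + y) + conv cat (λ j → count ψ a (x + y + j)) k ∎
  where
  open ≡-Reasoning
  k = size t
  e′ = suc (e + 0)
  e′≡ : e′ ≡ suc e
  e′≡ = cong suc (+-identityʳ e)
  shuffle : ∀ p n b → (p ∨ n) ∨ b ≡ p ∨ (b ∨ (false ∨ n))
  shuffle true  _     _     = refl
  shuffle false true  true  = refl
  shuffle false true  false = refl
  shuffle false false true  = refl
  shuffle false false false = refl
  bounds : ∀ i s → nodes e′ t i s ≡ true → e ≤ i × i + s ≤ e + suc k × s ≤ k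
  bounds i s eq with e′≤i , i+s≤ , _ ← nodes-bounds e′ t i s eq =
    ≤-trans (n≤1+n e) (subst (_≤ i) e′≡ e′≤i) ,
    ≤-trans i+s≤ (≤-reflexive (trans (cong (_+ k) e′≡) (sym (+-suc e k)))) ,
    +-cancelˡ-≤ e′ s k (≤-trans (+-monoˡ-≤ s e′≤i) i+s≤)
  -- The leaf added on the left lets the inner chain start at e + 1, so the vertex e joins the x
  -- vertices before it.
  ih : ∀ a x y → a + x ≡ e → count ψ a (suc (x + k + y)) ≡
    count (ψ ∪ nodes e′ t) a (suc (x + k + y)) + ∑ k (λ i → cat i * count ψ a (x + y + (k ∸ i)))
  ih a x y a+x≡e = trans
    (count-chain c ψ e′ (λ i s le → ψ-left i s (≤-trans (n≤1+n e) (subst (_≤ i + s) e′≡ le)))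
       a (suc x) y (trans (+-suc a x) (trans (cong suc a+x≡e) (sym e′≡))))
    (cong (count (ψ ∪ nodes e′ t) a (suc (x + k + y)) +_) (∑-cong k λ i i<k →
      cong (λ j → cat i * count ψ a j) (trans (sym (+-suc (x + y) (k ∸ suc i)))
        (cong (x + y +_) (sym (+-∸-assoc 1 i<k))))))
count-chain (growʳ {t} c) ψ e ψ-left a x y a+x≡e = begin
  count ψ a (x + suc (k + 0) + y)
    ≡⟨ cong (count ψ a) size≡ ⟩
  count ψ a (suc (x + k + y))
    ≡⟨ grow ψ (nodes e t) e k ψ-left bounds ih a x y a+x≡e ⟩
  count ((ψ ∪ nodes e t) ∪ ⟪ e , suc k ⟫) a (suc (x + k + y)) + conv cat (λ j → count ψ a (x + y + j)) k
    ≡⟨ cong₂ _+_ (trans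
         (count-cong {(ψ ∪ nodes e t) ∪ ⟪ e , suc k ⟫} {ψ ∪ nodes e (node t leaf)} {a} {a} (suc (x + k + y)) λ z s _ → trans
           (shuffle (ψ (a + z) (suc s)) (nodes e t (a + z) (suc s)) (⟪ e , suc k ⟫ (a + z) (suc s)))
           (cong (λ j → ψ (a + z) (suc s) ∨ (⟪ e , suc j ⟫ (a + z) (suc s) ∨ (nodes e t (a + z) (suc s) ∨ false))) (sym (+-identityʳ k))))
         (cong (count (ψ ∪ nodes e (node t leaf)) a) (sym size≡)))
         (cong (conv cat (λ j → count ψ a (x + y + j))) (sym (+-identityʳ k))) ⟩
  count (ψ ∪ nodes e (node t leaf)) a (x + suc (k + 0) + y) + conv cat (λ j → count ψ a (x + y + j)) (k + 0) ∎
  where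
  open ≡-Reasoning
  k = size t
  size≡ : x + suc (k + 0) + y ≡ suc (x + k + y)
  size≡ = trans (cong (λ j → x + suc j + y) (+-identityʳ k)) (cong (_+ y) (+-suc x k))
  shuffle : ∀ p n b → (p ∨ n) ∨ b ≡ p ∨ (b ∨ (n ∨ false))
  shuffle true  _     _     = refl
  shuffle false true  true  = refl
  shuffle false true  false = refl
  shuffle false false true  = refl
  shuffle false false false = refl
  bounds : ∀ i s → nodes e t i s ≡ true → e ≤ i × i + s ≤ e + suc k × s ≤ k
  bounds i s eq with e≤i , i+s≤ , _ ← nodes-bounds e t i s eq =
    e≤i , ≤-trans i+s≤ (+-monoʳ-≤ e (n≤1+n k)) ,
    +-cancelˡ-≤ e s k (≤-trans (+-monoˡ-≤ s e≤i) i+s≤)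
  -- The leaf added on the right keeps the start at e, and the last vertex joins the y vertices
  -- after the inner chain.
  ih : ∀ a x y → a + x ≡ e → count ψ a (suc (x + k + y)) ≡
    count (ψ ∪ nodes e t) a (suc (x + k + y)) + ∑ k (λ i → cat i * count ψ a (x + y + (k ∸ i)))
  ih a x y a+x≡e = trans (cong (count ψ a) (sym (+-suc (x + k) y)))
    (trans (count-chain c ψ e ψ-left a x (suc y) a+x≡e)
      (cong₂ _+_ (cong (count (ψ ∪ nodes e t) a) (+-suc (x + k) y)) (∑-cong k λ i i<k →
        cong (λ j → cat i * count ψ a j) (trans (cong (_+ (k ∸ suc i)) (+-suc x y)) (trans (sym (+-suc (x + y) (k ∸ suc i)))
          (cong (x + y +_) (sym (+-∸-assoc 1 i<k))))))))

-- In generating functions, this is C = 1 + z C² multiplied by U.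
conv-cat : ∀ (u : ℕ → ℕ) n → conv u cat n ≡ u n + ∑ n (λ i → cat i * conv u cat (n ∸ suc i))
conv-cat u zero    = cong (_+ 0) (*-identityʳ (u 0))
conv-cat u (suc n) = begin
  conv u cat (suc n)                       ≡⟨ conv-sucʳ u cat n ⟩
  conv u (cat ∘ suc) n + u (suc n) * 1     ≡⟨ cong₂ _+_ (conv-cong {u} n (λ _ _ → refl) (λ i _ → cat-suc i)) (*-identityʳ (u (suc n))) ⟩
  conv u (conv cat cat) n + u (suc n)      ≡⟨ cong (_+ u (suc n)) (conv-assoc u cat cat n) ⟨
  conv (conv u cat) cat n + u (suc n)      ≡⟨ cong (_+ u (suc n)) (conv-comm (conv u cat) cat n) ⟩
  conv cat (conv u cat) n + u (suc n)      ≡⟨ +-comm _ (u (suc n)) ⟩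
  u (suc n) + conv cat (conv u cat) n      ∎
  where open ≡-Reasoning

-- The root is left out because it stands for a side of the polygon. The two chains meet in its
-- apex, the vertex `suc (size l)`.
innerNodes : Shape → Shape → Forbidden
innerNodes l r = nodes 0 l ∪ nodes (suc (size l)) r

count-disjoint : ∀ {l r} → Chain l → Chain r → count (innerNodes l r) 0 (suc (size l + size r)) ≡ cat (size l + size r)
count-disjoint {l} {r} cl cr = +-cancelʳ-≡ S _ _ (begin
  count (D ∪ nodes (suc p) r) 0 (suc (p + q)) + S
    ≡⟨ cong₂ _+_ (cong (count (D ∪ nodes (suc p) r) 0) (+-identityʳ (suc (p + q))))
         (∑-cong q λ i i<q → cong (cat i *_) (trans (cong (count D 0) (cong (λ j → suc j + (q ∸ suc i)) (+-identityʳ p))) (tail (q ∸ suc i)))) ⟨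
  count (D ∪ nodes (suc p) r) 0 (suc p + q + 0) + ∑ q (λ i → cat i * count D 0 (suc p + 0 + (q ∸ suc i)))
    ≡⟨ count-chain cr D (suc p) D-left 0 (suc p) 0 refl ⟨
  count D 0 (suc p + q + 0)
    ≡⟨ trans (cong (count D 0) (+-identityʳ (suc (p + q)))) (tail q) ⟩
  conv u cat q
    ≡⟨ conv-cat u q ⟩
  cat (p + q) + S ∎)
  where
  open ≡-Reasoning
  p = size l
  q = size r
  D = nodes 0 l
  u = λ i → cat (p + i)
  S = ∑ q (λ i → cat i * conv u cat (q ∸ suc i))
  D-left : LeftOf (suc p) D
  D-left i s lt = ¬-not λ eq → <⇒≱ lt (proj₁ (proj₂ (nodes-bounds 0 l i s eq)))

  -- Split the recurrence for c(p + j + 1) at i = p. Its first p terms, collected in `R`, are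
  -- exactly the trees lost to the left chain.
  tail : ∀ j → count D 0 (suc (p + j)) ≡ conv u cat j
  tail j = +-cancelʳ-≡ R _ _ (begin
    count D 0 (suc (p + j)) + R
      ≡⟨ cong₂ _+_ (cong (count D 0) (+-suc p j)) (∑-cong p λ i i<p → cong (λ m → cat i * cat m) (index i i<p)) ⟨
    count (∅ ∪ D) 0 (p + suc j) + ∑ p (λ i → cat i * cat (suc j + (p ∸ suc i)))
      ≡⟨ count-chain cl ∅ 0 (λ _ _ _ → refl) 0 0 (suc j) refl ⟨
    cat (p + suc j)
      ≡⟨ trans (cong cat (+-suc p j)) (cat-suc (p + j)) ⟩
    conv cat cat (p + j)
      ≡⟨ cong (λ m → ∑ m (λ i → cat i * cat (p + j ∸ i))) (+-suc p j) ⟨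
    ∑ (p + suc j) (λ i → cat i * cat (p + j ∸ i))
      ≡⟨ ∑-split p (suc j) (λ i → cat i * cat (p + j ∸ i)) ⟩
    R + ∑ (suc j) (λ i → cat (p + i) * cat (p + j ∸ (p + i)))
      ≡⟨ cong (R +_) (∑-cong (suc j) λ i _ → cong (λ m → cat (p + i) * cat m) ([m+n]∸[m+o]≡n∸o p j i)) ⟩
    R + conv u cat j
      ≡⟨ +-comm R _ ⟩
    conv u cat j + R ∎)
    where
    R = ∑ p (λ i → cat i * cat (p + j ∸ i))
    index : ∀ i → i < p → suc j + (p ∸ suc i) ≡ p + j ∸ i
    index i i<p = trans (sym (+-suc j (p ∸ suc i))) (trans (cong (j +_) (sym (+-∸-assoc 1 i<p)))
      (trans (sym (+-∸-assoc j (<⇒≤ i<p))) (cong (_∸ i) (+-comm j p))))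

-- Triangulations as binary trees

-- Segments are given here by both end vertices, as the crossing condition needs, whereas `nodes`
-- gives them by start and size.
Node : ℕ → Shape → ℕ → ℕ → Set
Node a leaf       i j = ⊥
Node a (node l r) i j =
  (i ≡ a × j ≡ suc (a + size (node l r))) ⊎ Node a l i j ⊎ Node (suc (a + size l)) r i j

node? : ∀ a t i j → Dec (Node a t i j)
node? a leaf       i j = no λ ()
node? a (node l r) i j =
  (i ≟ a ×-dec j ≟ suc (a + size (node l r))) ⊎-dec node? a l i j ⊎-dec node? (suc (a + size l)) r i j

size-split : ∀ a x y → suc (suc (a + x) + y) ≡ suc (a + suc (x + y))
size-split = solve-∀

Node-bounds : ∀ a t {i j} → Node a t i j → a ≤ i × suc i < j × j ≤ suc (a + size t)
Node-bounds a (node l r) (inj₁ (refl , refl)) =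
  ≤-refl , s≤s (subst (suc a ≤_) (sym (+-suc a _)) (s≤s (m≤m+n a _))) , ≤-refl
Node-bounds a (node l r) (inj₂ (inj₁ inl)) with a≤i , i<j , j≤ ← Node-bounds a l inl =
  a≤i , i<j , ≤-trans j≤ (s≤s (+-monoʳ-≤ a (m≤n⇒m≤1+n (m≤m+n (size l) (size r)))))
Node-bounds a (node l r) (inj₂ (inj₂ inr)) with a≤i , i<j , j≤ ← Node-bounds (suc (a + size l)) r inr =
  ≤-trans (m≤n⇒m≤1+n (m≤m+n a (size l))) a≤i , i<j , ≤-trans j≤ (≤-reflexive (size-split a (size l) (size r)))

Node-nonCrossing : ∀ a t {i j k l} → Node a t i j → Node a t k l → ¬ (i < k × k < j × j < l)
Node-nonCrossing a (node _ _) (inj₁ (refl , refl)) kl (_ , _ , j<l) =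
  <⇒≱ j<l (proj₂ (proj₂ (Node-bounds a _ kl)))
Node-nonCrossing a (node _ _) ij@(inj₂ _) (inj₁ (refl , refl)) (i<k , _ , _) =
  <⇒≱ i<k (proj₁ (Node-bounds a _ ij))
Node-nonCrossing a (node x y) (inj₂ (inj₁ ij)) (inj₂ (inj₁ kl)) = Node-nonCrossing a x ij kl
Node-nonCrossing a (node x y) (inj₂ (inj₂ ij)) (inj₂ (inj₂ kl)) = Node-nonCrossing (suc (a + size x)) y ij kl
Node-nonCrossing a (node x y) (inj₂ (inj₁ ij)) (inj₂ (inj₂ kl)) (_ , k<j , _) =
  <⇒≱ k<j (≤-trans (proj₂ (proj₂ (Node-bounds a x ij))) (proj₁ (Node-bounds (suc (a + size x)) y kl)))
Node-nonCrossing a (node x y) (inj₂ (inj₂ ij)) (inj₂ (inj₁ kl)) (i<k , k<j , j<l) =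
  <⇒≱ (<-trans i<k (<-trans k<j j<l))
      (≤-trans (proj₂ (proj₂ (Node-bounds a x kl))) (proj₁ (Node-bounds (suc (a + size x)) y ij)))

-- A child of a node may be a leaf, that is, a side of the polygon, which `E` does not list.
_⁺ : (ℕ → ℕ → Set) → ℕ → ℕ → Set
(E ⁺) i j = j ≡ suc i ⊎ E i j

Node⁺-top : ∀ a t → (Node a t ⁺) a (suc (a + size t))
Node⁺-top a leaf       = inj₁ (cong suc (+-identityʳ a))
Node⁺-top a (node l r) = inj₂ (inj₁ (refl , refl))

-- The third vertex of the triangle below the segment ij.
Apex : (ℕ → ℕ → Set) → ℕ → ℕ → Set
Apex E i j = Σ[ c ∈ ℕ ] i < c × c < j × (E ⁺) i c × (E ⁺) c j

Apex-map : ∀ {E F : ℕ → ℕ → Set} {i j} → (∀ {i j} → E i j → F i j) → Apex E i j → Apex F i j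
Apex-map f (c , i<c , c<j , ic , cj) = c , i<c , c<j , Sum.map₂ f ic , Sum.map₂ f cj

Node-apex : ∀ a t {i j} → Node a t i j → Apex (Node a t) i j
Node-apex a (node l r) (inj₁ (refl , refl)) =
  suc (a + size l) , s≤s (m≤m+n a (size l)) ,
  s≤s (subst (_≤ a + suc (size l + size r)) (+-suc a (size l)) (+-monoʳ-≤ a (s≤s (m≤m+n (size l) (size r))))) ,
  Sum.map₂ (inj₂ ∘ inj₁) (Node⁺-top a l) ,
  subst (((Node a (node l r)) ⁺) (suc (a + size l))) (size-split a (size l) (size r))
        (Sum.map₂ (inj₂ ∘ inj₂) (Node⁺-top (suc (a + size l)) r))
Node-apex a (node l r) (inj₂ (inj₁ inl)) = Apex-map (inj₂ ∘ inj₁) (Node-apex a l inl)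
Node-apex a (node l r) (inj₂ (inj₂ inr)) = Apex-map (inj₂ ∘ inj₂) (Node-apex (suc (a + size l)) r inr)

-- E consists of the base segment 0N and the diagonals.
record TriangulatesBelow (N : ℕ) (E : ℕ → ℕ → Set) : Set where
  field
    base        : E 0 N
    bounds      : ∀ {i j} → E i j → suc i < j × j ≤ N
    nonCrossing : ∀ {i j k l} → E i j → E k l → ¬ (i < k × k < j × j < l)
    apex        : ∀ {i j} → E i j → Apex E i j

Node-triangulates : ∀ l r → TriangulatesBelow (suc (size (node l r))) (Node 0 (node l r))
Node-triangulates l r = record
  { base        = inj₁ (refl , refl)
  ; bounds      = λ ij → proj₂ (Node-bounds 0 (node l r) ij)
  ; nonCrossing = Node-nonCrossing 0 (node l r)
  ; apex        = Node-apex 0 (node l r)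
  }

module _ {N E} (tri : TriangulatesBelow N E) where
  open TriangulatesBelow tri

  -- If i were beyond a, the segment ij would cross ac; if j were short of b, it would cross cb.
  straddle : ∀ {a c b i j} → (E ⁺) a c → (E ⁺) c b → E i j → a ≤ i → j ≤ b → i < c → c < j →
             i ≡ a × j ≡ b
  straddle {a} {c} {b} {i} {j} ac cb ij a≤i j≤b i<c c<j with <-cmp a i
  straddle (inj₁ refl) _ _ _ _ i<c _ | tri< a<i _ _ = contradiction a<i (≤⇒≯ (≤-pred i<c))
  straddle (inj₂ ac) _ ij _ _ i<c c<j | tri< a<i _ _ = contradiction (a<i , i<c , c<j) (nonCrossing ac ij)
  straddle _ _ _ a≤i _ _ _ | tri> _ _ i<a = contradiction a≤i (<⇒≱ i<a)
  straddle {b = b} {j = j} _ cb ij _ j≤b i<c c<j | tri≈ _ refl _ with <-cmp j b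
  ... | tri≈ _ j≡b _ = refl , j≡b
  ... | tri> _ _ b<j = contradiction j≤b (<⇒≱ b<j)
  straddle _ (inj₁ refl) _ _ _ _ c<j | tri≈ _ refl _ | tri< j<b _ _ = contradiction c<j (≤⇒≯ (≤-pred j<b))
  straddle _ (inj₂ cb) ij _ _ i<c c<j | tri≈ _ refl _ | tri< j<b _ _ = contradiction (i<c , c<j , j<b) (nonCrossing ij cb)

  NodesOf : ℕ → Shape → Set
  NodesOf a t = ∀ i j → Node a t i j ⇔ (E i j × a ≤ i × j ≤ suc (a + size t))

  NodesOf-node : ∀ a l r → let c = suc (a + size l); b = suc (a + size (node l r)) in
    E a b → (E ⁺) a c → (E ⁺) c b → NodesOf a l → NodesOf c r → NodesOf a (node l r)
  NodesOf-node a l r ab ac cb L R i j = mk⇔ to from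
    where
    c = suc (a + size l)
    b = suc (a + size (node l r))
    to : Node a (node l r) i j → E i j × a ≤ i × j ≤ b
    to (inj₁ (i≡a , j≡b)) = subst₂ E (sym i≡a) (sym j≡b) ab , ≤-reflexive (sym i≡a) , ≤-reflexive j≡b
    to (inj₂ (inj₁ inl)) with ij , a≤i , _ ← Equivalence.to (L i j) inl =
      ij , a≤i , proj₂ (proj₂ (Node-bounds a (node l r) (inj₂ (inj₁ inl))))
    to (inj₂ (inj₂ inr)) with ij , _ , _ ← Equivalence.to (R i j) inr =
      ij , proj₁ (Node-bounds a (node l r) (inj₂ (inj₂ inr))) , proj₂ (proj₂ (Node-bounds a (node l r) (inj₂ (inj₂ inr))))
    from : E i j × a ≤ i × j ≤ b → Node a (node l r) i j
    from (ij , a≤i , j≤b) with j ≤? c | c ≤? i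
    ... | yes j≤c | _       = inj₂ (inj₁ (Equivalence.from (L i j) (ij , a≤i , j≤c)))
    ... | no _    | yes c≤i = inj₂ (inj₂ (Equivalence.from (R i j)
      (ij , c≤i , subst (j ≤_) (sym (size-split a (size l) (size r))) j≤b)))
    ... | no j≰c  | no c≰i  = inj₁ (straddle ac cb ij a≤i j≤b (≰⇒> c≰i) (≰⇒> j≰c))

  short : ∀ x z → (E ⁺) x (suc (x + z)) → z ≡ 0 ⊎ E x (suc (x + z))
  short x z = Sum.map₁ λ eq → +-cancelˡ-≡ x z 0 (trans (suc-injective eq) (sym (+-identityʳ x)))

  -- The apex divides the k vertices inside the segment into k₁, itself and k₂, which gives the
  -- sizes of the two subtrees. No segment is missed, since by `straddle` one passing over the apex
  -- is the segment itself.
  toShape′ : ∀ f a k → k ≤ f → k ≡ 0 ⊎ E a (suc (a + k)) → Σ[ t ∈ Shape ] size t ≡ k × NodesOf a t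
  toShape′ f a zero _ _ = leaf , refl , λ i j → mk⇔ (λ ()) λ (ij , a≤i , j≤) →
    <⇒≱ (proj₁ (bounds ij)) (≤-trans j≤ (s≤s (subst (_≤ i) (sym (+-identityʳ a)) a≤i)))
  toShape′ (suc f) a (suc k) (s≤s k≤f) (inj₂ ab)
    with c , a<c , c<b , ac , cb ← apex ab
    with k₁ , refl ← difference a<c
    with k₂ , b≡ ← difference c<b
    with refl ← suc-injective (+-cancelˡ-≡ (suc a) _ _ (trans b≡ (size-split a k₁ k₂)))
    with l , refl , L ← toShape′ f a k₁ (≤-trans (m≤m+n k₁ k₂) k≤f) (short a k₁ ac)
    with r , refl , R ← toShape′ f (suc (a + k₁)) k₂ (≤-trans (m≤n+m k₂ k₁) k≤f)
                          (short (suc (a + k₁)) k₂ (subst ((E ⁺) (suc (a + k₁))) b≡ cb)) =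
    node l r , refl , NodesOf-node a l r ab ac cb L R

toShape : ∀ {p E} → TriangulatesBelow (suc p) E →
  Σ[ t ∈ Shape ] size t ≡ p × (∀ i j → Node 0 t i j ⇔ E i j)
toShape {p} tri with t , refl , nodesOf ← toShape′ tri p 0 p ≤-refl (inj₂ (TriangulatesBelow.base tri)) =
  t , refl , λ i j → mk⇔ (λ ij → proj₁ (Equivalence.to (nodesOf i j) ij))
    (λ ij → Equivalence.from (nodesOf i j) (ij , z≤n , proj₂ (TriangulatesBelow.bounds tri ij)))

-- Trees of equal size have equally many nodes, so an inclusion of node sets is an equality. Were
-- the apexes of the roots different, the larger-than-expected child of the root of `t` would pass
-- over the apex of `t′` and lie in neither of its subtrees.
Node-injective : ∀ a t t′ → size t ≡ size t′ → (∀ i j → Node a t i j → Node a t′ i j) → t ≡ t′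
Node-injective a leaf leaf _ _ = refl
Node-injective a (node l r) (node l′ r′) size≡ sub with <-cmp (size l) (size l′)
... | tri≈ _ l≡ _ = cong₂ node
    (Node-injective a l l′ l≡ λ i j ij → onlyˡ i j ij (sub i j (inj₂ (inj₁ ij))))
    (Node-injective (suc (a + size l)) r r′ r≡ λ i j ij → onlyʳ i j ij (sub i j (inj₂ (inj₂ ij))))
  where
  r≡ : size r ≡ size r′
  r≡ = +-cancelˡ-≡ (size l) _ _ (trans (suc-injective size≡) (cong (_+ size r′) (sym l≡)))
  onlyˡ : ∀ i j → Node a l i j → Node a (node l′ r′) i j → Node a l′ i j
  onlyˡ i j ij (inj₁ (refl , refl)) = contradiction (proj₂ (proj₂ (Node-bounds a l ij)))
    (<⇒≱ (s≤s (+-monoʳ-< a (s≤s (subst (size l ≤_) (suc-injective size≡) (m≤m+n (size l) (size r)))))))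
  onlyˡ i j ij (inj₂ (inj₁ inl)) = inl
  onlyˡ i j ij (inj₂ (inj₂ inr)) with _ , i<j , j≤ ← Node-bounds a l ij =
    contradiction (≤-trans (≤-trans (n≤1+n _) i<j) j≤)
      (≤⇒≯ (subst (λ z → suc (a + z) ≤ i) (sym l≡) (proj₁ (Node-bounds _ r′ inr))))
  onlyʳ : ∀ i j → Node (suc (a + size l)) r i j → Node a (node l′ r′) i j → Node (suc (a + size l)) r′ i j
  onlyʳ i j ij (inj₁ (refl , refl)) = contradiction (proj₁ (Node-bounds _ r ij)) (<⇒≱ (s≤s (m≤m+n a (size l))))
  onlyʳ i j ij (inj₂ (inj₁ inl)) with _ , i<j , j≤ ← Node-bounds a l′ inl =
    contradiction (≤-trans (≤-trans (n≤1+n _) i<j) j≤)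
      (≤⇒≯ (subst (λ z → suc (a + z) ≤ i) l≡ (proj₁ (Node-bounds _ r ij))))
  onlyʳ i j ij (inj₂ (inj₂ inr)) = subst (λ z → Node (suc (a + z)) r′ i j) (sym l≡) inr
... | tri< l<l′ _ _ = ⊥-elim (absurd r refl)
  where
  absurd : ∀ s → s ≡ r → ⊥
  absurd leaf refl = <⇒≱ (s≤s l<l′) (subst (suc (size l′) ≤_) (cong suc (+-identityʳ (size l)))
    (subst (suc (size l′) ≤_) (sym size≡) (s≤s (m≤m+n (size l′) (size r′)))))
  absurd (node x y) refl with sub _ _ (inj₂ (inj₂ (inj₁ (refl , refl))))
  ... | inj₁ (c≡a , _) = <⇒≢ (s≤s (m≤m+n a (size l))) (sym c≡a)
  ... | inj₂ (inj₁ inl) = <⇒≱ (s≤s (+-monoʳ-< a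
          (<-≤-trans (s≤s (m≤m+n (size l′) (size r′))) (≤-reflexive (sym size≡)))))
          (subst (_≤ suc (a + size l′)) (size-split a (size l) (size r)) (proj₂ (proj₂ (Node-bounds a l′ inl))))
  ... | inj₂ (inj₂ inr) = <⇒≱ (s≤s (+-monoʳ-< a l<l′)) (proj₁ (Node-bounds _ r′ inr))
... | tri> _ _ l′<l = ⊥-elim (absurd l refl)
  where
  absurd : ∀ s → s ≡ l → ⊥
  absurd leaf refl = contradiction l′<l λ ()
  absurd (node x y) refl with sub _ _ (inj₂ (inj₁ (inj₁ (refl , refl))))
  ... | inj₁ (_ , c≡b) = <⇒≢ (s≤s (m≤m+n (size l) (size r)))
          (+-cancelˡ-≡ (suc a) (size l) (suc (size l + size r)) (trans c≡b (cong (λ z → suc (a + z)) (sym size≡))))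
  ... | inj₂ (inj₁ inl) = <⇒≱ (s≤s (+-monoʳ-< a l′<l)) (proj₂ (proj₂ (Node-bounds a l′ inl)))
  ... | inj₂ (inj₂ inr) = <⇒≱ (s≤s (m≤m+n a (size l′))) (proj₁ (Node-bounds _ r′ inr))

Node⇒nodes : ∀ a t i s → Node a t i (suc (i + s)) → nodes a t i s ≡ true
Node⇒nodes a (node l r) i s (inj₁ (refl , eq))
  with refl ← +-cancelˡ-≡ (suc a) s (size (node l r)) eq rewrite ⟪⟫-refl a (size (node l r)) = refl
Node⇒nodes a (node l r) i s (inj₂ (inj₁ inl)) rewrite Node⇒nodes a l i s inl = ∨-zeroʳ _
Node⇒nodes a (node l r) i s (inj₂ (inj₂ inr))
  rewrite Node⇒nodes (suc (a + size l)) r i s inr | ∨-zeroʳ (nodes a l i s) = ∨-zeroʳ _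

nodes⇒Node : ∀ a t i s → nodes a t i s ≡ true → Node a t i (suc (i + s))
nodes⇒Node a (node l r) i s eq with ∨-true (⟪ a , size (node l r) ⟫ i s) _ eq
... | inj₁ top with refl , refl ← ⟪⟫⇒≡ a (size (node l r)) i s top = inj₁ (refl , refl)
... | inj₂ below with ∨-true (nodes a l i s) _ below
...   | inj₁ inl = inj₂ (inj₁ (nodes⇒Node a l i s inl))
...   | inj₂ inr = inj₂ (inj₂ (nodes⇒Node (suc (a + size l)) r i s inr))

Avoids⁺ : ∀ χ a t → (∀ i s → Node a t i (suc (i + s)) → χ i s ≡ false) → Avoids χ a t
Avoids⁺ χ a leaf       _ = tt
Avoids⁺ χ a (node l r) h = h a _ (inj₁ (refl , refl)) ,
  Avoids⁺ χ a l (λ i s → h i s ∘ inj₂ ∘ inj₁) ,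
  Avoids⁺ χ (suc (a + size l)) r (λ i s → h i s ∘ inj₂ ∘ inj₂)

Avoids⁻ : ∀ χ a t → Avoids χ a t → ∀ i s → Node a t i (suc (i + s)) → χ i s ≡ false
Avoids⁻ χ a (node l r) (root , _ , _) i s (inj₁ (refl , eq))
  with refl ← +-cancelˡ-≡ (suc a) s (size (node l r)) eq = root
Avoids⁻ χ a (node l r) (_ , al , _) i s (inj₂ (inj₁ inl)) = Avoids⁻ χ a l al i s inl
Avoids⁻ χ a (node l r) (_ , _ , ar) i s (inj₂ (inj₂ inr)) = Avoids⁻ χ (suc (a + size l)) r ar i s inr

-- The apex below a segment of a triangulation

greatest : ∀ {P : ℕ → Set} → (∀ k → Dec (P k)) → ∀ lo hi → lo ≤ hi → P lo →
  Σ[ j ∈ ℕ ] lo ≤ j × j ≤ hi × P j × (∀ k → j < k → k ≤ hi → ¬ P k)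
greatest P? lo hi lo≤hi p with P? hi
... | yes q = hi , lo≤hi , ≤-refl , q , λ k hi<k k≤hi _ → <⇒≱ hi<k k≤hi
greatest P? .zero zero z≤n p | no ¬q = contradiction p ¬q
greatest P? lo (suc hi) lo≤hi p | no ¬q with m≤n⇒m<n∨m≡n lo≤hi
... | inj₂ refl = contradiction p ¬q
... | inj₁ (s≤s lo≤hi′) with j , lo≤j , j≤hi , q , max ← greatest P? lo hi lo≤hi′ p =
  j , lo≤j , m≤n⇒m≤1+n j≤hi , q , above
  where
  above : ∀ k → j < k → k ≤ suc hi → ¬ _
  above k j<k k≤1+hi with m≤n⇒m<n∨m≡n k≤1+hi
  ... | inj₁ (s≤s k≤hi) = max k j<k k≤hi
  ... | inj₂ refl       = ¬q

least : ∀ {P : ℕ → Set} → (∀ k → Dec (P k)) → ∀ lo d → P (lo + d) →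
  Σ[ j ∈ ℕ ] lo ≤ j × P j × (∀ k → lo ≤ k → k < j → ¬ P k)
least {P} P? lo zero p = lo , ≤-refl , subst P (+-identityʳ lo) p , λ k lo≤k k<lo _ → <⇒≱ k<lo lo≤k
least {P} P? lo (suc d) p with P? lo
... | yes q = lo , ≤-refl , q , λ k lo≤k k<lo _ → <⇒≱ k<lo lo≤k
... | no ¬q with j , lo<j , q , min ← least P? (suc lo) d (subst P (+-suc lo d) p) = j , <⇒≤ lo<j , q , below
  where
  below : ∀ k → lo ≤ k → k < j → ¬ _
  below k lo≤k k<j with m≤n⇒m<n∨m≡n lo≤k
  ... | inj₁ lo<k = min k lo<k k<j
  ... | inj₂ refl = ¬q

abstract

  subset : ∀ {n} {P : Fin n → Set} → (∀ v → Dec (P v)) → Subset n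
  subset P? = tabulate (does ∘ P?)

  ∈-subset⁺ : ∀ {n} {P : Fin n → Set} (P? : ∀ v → Dec (P v)) {v} → P v → v ∈ subset P?
  ∈-subset⁺ P? {v} p = lookup⇒[]= v (subset P?) (trans (lookup∘tabulate (does ∘ P?) v) (dec-true (P? v) p))

  ∈-subset⁻ : ∀ {n} {P : Fin n → Set} (P? : ∀ v → Dec (P v)) {v} → v ∈ subset P? → P v
  ∈-subset⁻ P? {v} v∈ with P? v | trans (sym (lookup∘tabulate (does ∘ P?) v)) ([]=⇒lookup v∈)
  ... | yes p | _ = p

-- Bounding the size of a vertex set by lists

length≤∣∣ : ∀ {n} {S : Subset n} {xs} → Unique xs → All (_∈ S) xs → length xs ≤ ∣ S ∣
length≤∣∣ [] [] = z≤n
length≤∣∣ (x∉ ∷ uniq) (x∈ ∷ xs∈) = ≤-<-trans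
  (length≤∣∣ uniq (All.zipWith (λ (x≢y , y∈) → x∈p∧x≢y⇒x∈p-y y∈ (x≢y ∘ sym)) (x∉ , xs∈)))
  (x∈p⇒∣p-x∣<∣p∣ x∈)

∣∪∣≤ : ∀ {n} (p q : Subset n) → ∣ p ∪ˢ q ∣ ≤ ∣ p ∣ + ∣ q ∣
∣∪∣≤ []            []            = z≤n
∣∪∣≤ (outside ∷ p) (outside ∷ q) = ∣∪∣≤ p q
∣∪∣≤ (outside ∷ p) (inside  ∷ q) = subst (suc ∣ p ∪ˢ q ∣ ≤_) (sym (+-suc ∣ p ∣ ∣ q ∣)) (s≤s (∣∪∣≤ p q))
∣∪∣≤ (inside  ∷ p) (outside ∷ q) = s≤s (∣∪∣≤ p q)
∣∪∣≤ (inside  ∷ p) (inside  ∷ q) = s≤s (≤-trans (∣∪∣≤ p q) (+-monoʳ-≤ ∣ p ∣ (n≤1+n ∣ q ∣)))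

elements : ∀ {n} → List (Fin n) → Subset n
elements []       = ∅ˢ
elements (x ∷ xs) = ⁅ x ⁆ ∪ˢ elements xs

∈-elements : ∀ {n x} {xs : List (Fin n)} → x List.∈ xs → x ∈ elements xs
∈-elements {xs = x ∷ xs} (here refl) = x∈p∪q⁺ (inj₁ (x∈⁅x⁆ x))
∈-elements {xs = x ∷ xs} (there x∈)  = x∈p∪q⁺ {p = ⁅ x ⁆} (inj₂ (∈-elements x∈))

∣elements∣≤length : ∀ {n} (xs : List (Fin n)) → ∣ elements xs ∣ ≤ length xs
∣elements∣≤length {n} []   = ≤-reflexive (∣⊥∣≡0 n)
∣elements∣≤length (x ∷ xs) = ≤-trans (∣∪∣≤ ⁅ x ⁆ (elements xs))
  (≤-trans (+-monoʳ-≤ ∣ ⁅ x ⁆ ∣ (∣elements∣≤length xs)) (≤-reflexive (cong (_+ length xs) (∣⁅x⁆∣≡1 x))))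

∣∣≤length : ∀ {n} {S : Subset n} xs → (∀ v → v ∈ S → v List.∈ xs) → ∣ S ∣ ≤ length xs
∣∣≤length xs covers = ≤-trans (p⊆q⇒∣p∣≤∣q∣ (∈-elements ∘ covers _)) (∣elements∣≤length xs)

-- From triangular regions to apexes

module _ {n : ℕ} (D : Segments n) where

  Has : ℕ → ℕ → Set
  Has i j = Σ[ u ∈ Fin n ] Σ[ v ∈ Fin n ] toℕ u ≡ i × toℕ v ≡ j × D ∋⟨ u , v ⟩

  has? : ∀ i j → Dec (Has i j)
  has? i j = any? λ u → any? λ v → toℕ u ≟ i ×-dec toℕ v ≟ j ×-dec v ∈? lookup D u

  has⁻ : ∀ u v → Has (toℕ u) (toℕ v) → D ∋⟨ u , v ⟩
  has⁻ u v (u′ , v′ , u≡ , v≡ , d) = subst₂ (D ∋⟨_,_⟩) (toℕ-injective u≡) (toℕ-injective v≡) d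

  -- The side from 0 to n - 1 is added to serve as the root of the tree.
  Below : ℕ → ℕ → Set
  Below i j = (i ≡ 0 × suc j ≡ n) ⊎ Has i j

module _ {p} (1≤p : 1 ≤ p) {D : Segments (suc (suc p))} (tri : Triangulation D) where

  private
    n = suc (suc p)
    N = suc p
    open Triangulation tri
    open NonCrossingDiagonals nonCrossingDiagonals renaming (nonCrossing to noncrossing)

    has-bounds : ∀ {i j} → Has D i j → suc i < j × j ≤ N
    has-bounds (u , v , refl , refl , d) with u<v , ¬side ← diagonals u v d =
      ≤∧≢⇒< u<v (λ eq → ¬side (u<v , inj₁ (sym eq))) , ≤-pred (toℕ<n v)

    has-nonCrossing : ∀ {i j k l} → Has D i j → Has D k l → ¬ (i < k × k < j × j < l)
    has-nonCrossing (u , v , refl , refl , d) (u′ , v′ , refl , refl , d′) = noncrossing u v u′ v′ d d′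

  -- The vertices between a and b that no other segment inside [a, b] hides from ab
  -- span the region below ab; that region being a triangle gives the apex.
  module Visible (a b : ℕ) (a+1<b : suc a < b) (b≤N : b ≤ N) (ab : Below D a b) where

    -- The segment ab itself is excepted, since it would hide every vertex between its ends.
    Uncovered : ℕ → Set
    Uncovered v = ∀ (k l : Fin n) → D ∋⟨ k , l ⟩ → a ≤ toℕ k → toℕ l ≤ b →
      ¬ (toℕ k ≡ a × toℕ l ≡ b) → ¬ (toℕ k < v × v < toℕ l)

    uncovered? : ∀ v → Dec (Uncovered v)
    uncovered? v = all? λ k → all? λ l → l ∈? lookup D k →-dec a ≤? toℕ k →-dec toℕ l ≤? b →-dec
      ¬? (toℕ k ≟ a ×-dec toℕ l ≟ b) →-dec ¬? (toℕ k <? v ×-dec v <? toℕ l)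

    InS : ℕ → Set
    InS v = a ≤ v × v ≤ b × Uncovered v

    inS? : ∀ v → Dec (InS v)
    inS? v = a ≤? v ×-dec v ≤? b ×-dec uncovered? v

    S : Subset n
    S = subset (inS? ∘ toℕ)

    covers : ∀ {i j v} → Has D i j → a ≤ i → j ≤ b → ¬ (i ≡ a × j ≡ b) → i < v → v < j → ¬ Uncovered v
    covers (k , l , refl , refl , d) a≤i j≤b ≢ab i<v v<j unc = unc k l d a≤i j≤b ≢ab (i<v , v<j)

    a∈ : InS a
    a∈ = ≤-refl , <⇒≤ (<-trans (n<1+n a) a+1<b) , λ k l _ a≤k _ _ (k<a , _) → <⇒≱ k<a a≤k

    b∈ : InS b
    b∈ = <⇒≤ (<-trans (n<1+n a) a+1<b) , ≤-refl , λ k l _ _ l≤b _ (_ , b<l) → <⇒≱ b<l l≤b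

    record Next (i : ℕ) : Set where
      field
        j       : ℕ
        i<j     : i < j
        edge    : (Has D ⁺) i j
        not-ab  : ¬ (i ≡ a × j ≡ b)
        inS     : InS j

    -- From i, the boundary of the region follows the longest segment or side within [a, b] other
    -- than ab. A segment hiding its far end j would start before i and hide i too, start at i
    -- against maximality, or start between i and j and cross ij.
    next : ∀ i → InS i → i < b → Next i
    next i (a≤i , _ , unc-i) i<b = found
      where
      P : ℕ → Set
      P k = (Has D ⁺) i k × ¬ (i ≡ a × k ≡ b)
      P? : ∀ k → Dec (P k)
      P? k = (k ≟ suc i ⊎-dec has? D i k) ×-dec ¬? (i ≟ a ×-dec k ≟ b)
      found : Next i
      -- The search starts from the side to i + 1, which differs from ab because a + 1 < b.
      found with j , i<j , j≤b , (ij , ≢ab) , max ← greatest P? (suc i) b i<b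
                   (inj₁ refl , λ { (refl , eq) → <⇒≢ a+1<b eq }) = record
        { j = j ; i<j = i<j ; edge = ij ; not-ab = ≢ab
        ; inS = ≤-trans a≤i (<⇒≤ i<j) , j≤b , λ k l d a≤k l≤b ≢ab′ (k<j , j<l) →
            crossed ij max k l d a≤k l≤b ≢ab′ k<j j<l i<j }
        where
        crossed : ∀ {j} → (Has D ⁺) i j → (∀ k → j < k → k ≤ b → ¬ P k) → ∀ k l → D ∋⟨ k , l ⟩ → a ≤ toℕ k → toℕ l ≤ b →
          ¬ (toℕ k ≡ a × toℕ l ≡ b) → toℕ k < j → j < toℕ l → i < j → ⊥
        crossed ij max k l d a≤k l≤b ≢ab′ k<j j<l i<j with <-cmp i (toℕ k)
        ... | tri≈ _ i≡k _ = max (toℕ l) j<l l≤b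
          (inj₂ (k , l , sym i≡k , refl , d) , λ (i≡a , l≡b) → ≢ab′ (trans (sym i≡k) i≡a , l≡b))
        ... | tri> _ _ k<i = unc-i k l d a≤k l≤b ≢ab′ (k<i , <-trans i<j j<l)
        crossed (inj₁ refl) max k l d a≤k l≤b ≢ab′ k<j j<l i<j | tri< i<k _ _ = <⇒≱ i<k (≤-pred k<j)
        crossed (inj₂ ij) max k l d a≤k l≤b ≢ab′ k<j j<l i<j | tri< i<k _ _ =
          has-nonCrossing ij (k , l , refl , refl , d) (i<k , k<j , j<l)

    vertex : ∀ v → v ≤ b → Fin n
    vertex v v≤b = fromℕ< (s≤s (≤-trans v≤b b≤N))

    toℕ-vertex : ∀ v v≤b → toℕ (vertex v v≤b) ≡ v
    toℕ-vertex v v≤b = toℕ-fromℕ< (s≤s (≤-trans v≤b b≤N))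

    vertex∈S : ∀ {v} → InS v → (v≤b : v ≤ b) → vertex v v≤b ∈ S
    vertex∈S {v} v∈ v≤b = ∈-subset⁺ (inS? ∘ toℕ) (subst InS (sym (toℕ-vertex v v≤b)) v∈)

    vertex-≢ : ∀ {u v} u≤b v≤b → u < v → vertex u u≤b ≢ vertex v v≤b
    vertex-≢ {u} {v} u≤b v≤b u<v eq =
      <⇒≢ u<v (trans (sym (toℕ-vertex u u≤b)) (trans (cong toℕ eq) (toℕ-vertex v v≤b)))

    S⁻ : ∀ {v : Fin n} → v ∈ S → InS (toℕ v)
    S⁻ = ∈-subset⁻ (inS? ∘ toℕ)

    c : Next a
    c = next a a∈ (<-trans (n<1+n a) a+1<b)

    module c = Next c

    c≤b : c.j ≤ b
    c≤b = proj₁ (proj₂ c.inS)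

    c<b : c.j < b
    c<b = ≤∧≢⇒< c≤b λ eq → c.not-ab (refl , eq)

    a≤b : a ≤ b
    a≤b = proj₁ (proj₂ a∈)

    region : Region D S
    region = record { polygon = polygon ; bounded = bounded ; undivided = undivided }
      where
      polygon : 3 ≤ ∣ S ∣
      polygon = length≤∣∣ {xs = vertex a a≤b ∷ vertex c.j c≤b ∷ vertex b ≤-refl ∷ []}
        ((vertex-≢ a≤b c≤b c.i<j ∷ vertex-≢ a≤b ≤-refl (<-trans c.i<j c<b) ∷ []) ∷ (vertex-≢ c≤b ≤-refl c<b ∷ []) ∷ [] ∷ [])
        (vertex∈S a∈ a≤b ∷ vertex∈S c.inS c≤b ∷ vertex∈S b∈ ≤-refl ∷ [])

      bounded : ∀ i j → Edge S i j → Side i j ⊎ D ∋⟨ i , j ⟩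
      bounded i j (i∈ , j∈ , i<j , inj₂ all) = conclude (subst₂ (Below D) a≡i b≡j ab)
        where
        a≡i : a ≡ toℕ i
        a≡i = ≤-antisym (proj₁ (S⁻ i∈)) (subst (toℕ i ≤_) (toℕ-vertex a a≤b) (proj₁ (all _ (vertex∈S a∈ a≤b))))
        b≡j : b ≡ toℕ j
        b≡j = ≤-antisym (subst (_≤ toℕ j) (toℕ-vertex b ≤-refl) (proj₂ (all _ (vertex∈S b∈ ≤-refl)))) (proj₁ (proj₂ (S⁻ j∈)))
        conclude : Below D (toℕ i) (toℕ j) → Side i j ⊎ D ∋⟨ i , j ⟩
        conclude (inj₁ ends) = inj₁ (i<j , inj₂ ends)
        conclude (inj₂ ij)   = inj₂ (has⁻ D i j ij)
      -- The successor of i has to be j: if earlier, it would be a vertex of `S` between i and j; if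
      -- later, the segment leading to it would hide j.
      bounded i j (i∈ , j∈ , i<j , inj₁ empty) = conclude x (<-cmp (Next.j x) (toℕ j)) (Next.edge x)
        where
        x : Next (toℕ i)
        x = next (toℕ i) (S⁻ i∈) (<-≤-trans i<j (proj₁ (proj₂ (S⁻ j∈))))
        conclude : (x : Next (toℕ i)) → Tri (Next.j x < toℕ j) (Next.j x ≡ toℕ j) (toℕ j < Next.j x) →
          (Has D ⁺) (toℕ i) (Next.j x) → Side i j ⊎ D ∋⟨ i , j ⟩
        conclude x (tri< x<j _ _) _ = contradiction
          (subst (toℕ i <_) (sym (toℕ-vertex _ x≤b)) (Next.i<j x) , subst (_< toℕ j) (sym (toℕ-vertex _ x≤b)) x<j)
          (empty _ (vertex∈S (Next.inS x) x≤b))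
          where
          x≤b : Next.j x ≤ b
          x≤b = proj₁ (proj₂ (Next.inS x))
        conclude x (tri> _ _ j<x) (inj₁ x≡) = contradiction (subst (toℕ j <_) x≡ j<x) (≤⇒≯ i<j)
        conclude x (tri> _ _ j<x) (inj₂ ix) = contradiction (proj₂ (proj₂ (S⁻ j∈)))
          (covers ix (proj₁ (S⁻ i∈)) (proj₁ (proj₂ (Next.inS x))) (Next.not-ab x) i<j j<x)
        conclude x (tri≈ _ x≡j _) (inj₁ x≡) = inj₁ (i<j , inj₁ (trans (sym x≡j) x≡))
        conclude x (tri≈ _ x≡j _) (inj₂ ix) = inj₂ (has⁻ D i j (subst (Has D (toℕ i)) x≡j ix))

      undivided : ∀ i j → i ∈ S → j ∈ S → D ∋⟨ i , j ⟩ → Edge S i j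
      undivided i j i∈ j∈ d = i∈ , j∈ , proj₁ (diagonals i j d) , kind (toℕ i ≟ a ×-dec toℕ j ≟ b)
        where
        kind : Dec (toℕ i ≡ a × toℕ j ≡ b) →
          (∀ k → k ∈ S → ¬ (i Fin.< k × k Fin.< j)) ⊎ (∀ k → k ∈ S → i Fin.≤ k × k Fin.≤ j)
        kind (yes (i≡a , j≡b)) = inj₂ λ k k∈ →
          subst (_≤ toℕ k) (sym i≡a) (proj₁ (S⁻ k∈)) , subst (toℕ k ≤_) (sym j≡b) (proj₁ (proj₂ (S⁻ k∈)))
        kind (no ≢ab) = inj₁ λ k k∈ (i<k , k<j) → proj₂ (proj₂ (S⁻ k∈)) i j d (proj₁ (S⁻ i∈)) (proj₁ (proj₂ (S⁻ j∈))) ≢ab (i<k , k<j)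

    -- Were the successor d of c different from b, the region would have the four vertices a, c, d
    -- and b.
    c-edge : (Has D ⁺) c.j b
    c-edge = conclude d (<-cmp (Next.j d) b)
      where
      d : Next c.j
      d = next c.j c.inS c<b
      conclude : (d : Next c.j) → Tri (Next.j d < b) (Next.j d ≡ b) (b < Next.j d) → (Has D ⁺) c.j b
      conclude d (tri≈ _ d≡b _) = subst (Has D ⁺ $ c.j) d≡b (Next.edge d)
      conclude d (tri> _ _ b<d) = contradiction (proj₁ (proj₂ (Next.inS d))) (<⇒≱ b<d)
      conclude d (tri< d<b _ _) = contradiction (≤-reflexive (regionsAreTriangles S region)) (<⇒≱ four)
        where
        d≤b : Next.j d ≤ b
        d≤b = <⇒≤ d<b
        a<d = <-trans c.i<j (Next.i<j d)
        four : 4 ≤ ∣ S ∣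
        four = length≤∣∣ {xs = vertex a a≤b ∷ vertex c.j c≤b ∷ vertex (Next.j d) d≤b ∷ vertex b ≤-refl ∷ []}
          ((vertex-≢ a≤b c≤b c.i<j ∷ vertex-≢ a≤b d≤b a<d ∷ vertex-≢ a≤b ≤-refl (<-trans c.i<j c<b) ∷ []) ∷
           (vertex-≢ c≤b d≤b (Next.i<j d) ∷ vertex-≢ c≤b ≤-refl c<b ∷ []) ∷
           (vertex-≢ d≤b ≤-refl d<b ∷ []) ∷ [] ∷ [])
          (vertex∈S a∈ a≤b ∷ vertex∈S c.inS c≤b ∷ vertex∈S (Next.inS d) d≤b ∷ vertex∈S b∈ ≤-refl ∷ [])

    apex : Apex (Below D) a b
    apex = c.j , c.i<j , c<b , Sum.map₂ inj₂ c.edge , Sum.map₂ inj₂ c-edge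

  Triangulation⇒ : TriangulatesBelow N (Below D)
  Triangulation⇒ = record
    { base = inj₁ (refl , refl) ; bounds = bounds ; nonCrossing = nonCrossing
    ; apex = λ {i} {j} ij → Visible.apex i j (proj₁ (bounds ij)) (proj₂ (bounds ij)) ij }
    where
    bounds : ∀ {i j} → Below D i j → suc i < j × j ≤ N
    bounds (inj₁ (refl , refl)) = s≤s 1≤p , ≤-refl
    bounds (inj₂ ij) = has-bounds ij
    nonCrossing : ∀ {i j k l} → Below D i j → Below D k l → ¬ (i < k × k < j × j < l)
    nonCrossing (inj₁ (refl , refl)) kl (_ , _ , j<l) = <⇒≱ j<l (proj₂ (bounds kl))
    nonCrossing _ (inj₁ (refl , refl)) (() , _)
    nonCrossing (inj₂ ij) (inj₂ kl) = has-nonCrossing ij kl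

-- From apexes back to triangular regions

module _ {p} {D : Segments (suc (suc p))} (tri : TriangulatesBelow (suc p) (Below D))
  (proper : ∀ {i j} → Has D i j → ¬ (i ≡ 0 × j ≡ suc p)) where

  private
    n = suc (suc p)
    N = suc p
    open TriangulatesBelow tri

    has⁺ : ∀ {u v} → D ∋⟨ u , v ⟩ → Below D (toℕ u) (toℕ v)
    has⁺ {u} {v} d = inj₂ (u , v , refl , refl , d)

  ⇒NonCrossingDiagonals : NonCrossingDiagonals D
  ⇒NonCrossingDiagonals = record
    { diagonals = λ i j d → <-trans (n<1+n _) (proj₁ (bounds (has⁺ d))) , λ where
        (_ , inj₁ j≡) → <⇒≢ (proj₁ (bounds (has⁺ d))) (sym j≡)
        (_ , inj₂ (i≡0 , j≡N)) → proper (i , j , refl , refl , d) (i≡0 , suc-injective j≡N)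
    ; nonCrossing = λ i j k l d d′ → nonCrossing (has⁺ d) (has⁺ d′) }

  module _ {S : Subset n} (region : Region D S) where
    open Region region

    private
      In : ℕ → Set
      In v = Σ[ u ∈ Fin n ] toℕ u ≡ v × u ∈ S

      in? : ∀ v → Dec (In v)
      in? v = any? λ u → toℕ u ≟ v ×-dec u ∈? S

      In⁺ : ∀ {u} → u ∈ S → In (toℕ u)
      In⁺ {u} u∈ = u , refl , u∈

      few : ∀ xs → (∀ v → v ∈ S → v List.∈ xs) → length xs ≤ 2 → ⊥
      few xs covers ≤2 = <⇒≱ polygon (≤-trans (∣∣≤length xs covers) ≤2)

    record Extremes : Set where
      field
        {a b}   : Fin n
        a∈      : a ∈ S
        b∈      : b ∈ S
        minimum : ∀ v → v ∈ S → toℕ a ≤ toℕ v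
        maximum : ∀ v → v ∈ S → toℕ v ≤ toℕ b

    extremes : Extremes
    extremes with nonempty? S
    ... | no empty = ⊥-elim (few [] (λ v v∈ → contradiction (v , v∈) empty) z≤n)
    ... | yes (x , x∈)
      with _ , _ , (a , refl , a∈) , min ← least in? 0 (toℕ x) (In⁺ x∈)
      with _ , _ , _ , (b , refl , b∈) , max ← greatest in? (toℕ x) N (≤-pred (toℕ<n x)) (In⁺ x∈) = record
      { a∈ = a∈ ; b∈ = b∈
      ; minimum = λ v v∈ → ≮⇒≥ λ v<a → min (toℕ v) z≤n v<a (In⁺ v∈)
      ; maximum = λ v v∈ → ≮⇒≥ λ b<v → max (toℕ v) b<v (≤-pred (toℕ<n v)) (In⁺ v∈) }

    open Extremes extremes

    private
      inner : ¬ (∀ v → v ∈ S → toℕ a < toℕ v → toℕ v < toℕ b → ⊥)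
      inner none = few (a ∷ b ∷ []) covers ≤-refl
        where
        covers : ∀ v → v ∈ S → v List.∈ a ∷ b ∷ []
        covers v v∈ with m≤n⇒m<n∨m≡n (minimum v v∈) | m≤n⇒m<n∨m≡n (maximum v v∈)
        ... | inj₂ a≡v | _ = here (toℕ-injective (sym a≡v))
        ... | _ | inj₂ v≡b = there (here (toℕ-injective v≡b))
        ... | inj₁ a<v | inj₁ v<b = ⊥-elim (none v v∈ a<v v<b)

      a+1<b : suc (toℕ a) < toℕ b
      a+1<b = ≰⇒> λ b≤1+a → inner λ v v∈ a<v v<b → <⇒≱ v<b (≤-trans b≤1+a a<v)

      edge⇒⁺ : ∀ i j → Edge S i j → (Below D ⁺) (toℕ i) (toℕ j)
      edge⇒⁺ i j edge with bounded i j edge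
      ... | inj₁ (_ , inj₁ j≡)   = inj₁ j≡
      ... | inj₁ (_ , inj₂ ends) = inj₂ (inj₁ ends)
      ... | inj₂ d               = inj₂ (has⁺ d)

      ab : Below D (toℕ a) (toℕ b)
      ab with edge⇒⁺ a b (a∈ , b∈ , <-trans (n<1+n _) a+1<b , inj₂ λ k k∈ → minimum k k∈ , maximum k k∈)
      ... | inj₁ b≡ = contradiction (sym b≡) (<⇒≢ a+1<b)
      ... | inj₂ ab = ab

    -- The extreme vertices a and b of `S` form an edge, which has an apex c. If c is in `S`, then
    -- ac and cb do not divide the region, so no further vertex lies between their ends.
    triangle : ∣ S ∣ ≡ 3
    triangle with c′ , a<c , c<b , ac , cb ← apex ab = conclude (fromℕ< c<n) (toℕ-fromℕ< c<n) a<c c<b ac cb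
      where
      c<n : c′ < n
      c<n = <-trans c<b (toℕ<n b)
      conclude : (c : Fin n) → ∀ {c′} → toℕ c ≡ c′ → toℕ a < c′ → c′ < toℕ b →
        (Below D ⁺) (toℕ a) c′ → (Below D ⁺) c′ (toℕ b) → ∣ S ∣ ≡ 3
      conclude c refl a<c c<b ac cb with c ∈? S
      ... | yes c∈ = ≤-antisym (∣∣≤length (a ∷ c ∷ b ∷ []) covers) polygon
        where
        emptyˡ : (Below D ⁺) (toℕ a) (toℕ c) → ∀ v → v ∈ S → toℕ a < toℕ v → ¬ toℕ v < toℕ c
        emptyˡ (inj₁ c≡) v v∈ a<v v<c = <⇒≱ v<c (subst (_≤ toℕ v) (sym c≡) a<v)
        emptyˡ (inj₂ (inj₁ (_ , c≡N))) v v∈ a<v v<c = <⇒≱ (toℕ<n b) (subst (_≤ toℕ b) c≡N c<b)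
        emptyˡ (inj₂ (inj₂ h)) v v∈ a<v v<c with undivided a c a∈ c∈ (has⁻ D a c h)
        ... | _ , _ , _ , inj₁ none = none v v∈ (a<v , v<c)
        ... | _ , _ , _ , inj₂ all  = <⇒≱ c<b (proj₂ (all b b∈))
        emptyʳ : (Below D ⁺) (toℕ c) (toℕ b) → ∀ v → v ∈ S → toℕ c < toℕ v → ¬ toℕ v < toℕ b
        emptyʳ (inj₁ b≡) v v∈ c<v v<b = <⇒≱ v<b (subst (_≤ toℕ v) (sym b≡) c<v)
        emptyʳ (inj₂ (inj₁ (c≡0 , _))) v v∈ c<v v<b = <⇒≱ a<c (subst (_≤ toℕ a) (sym c≡0) z≤n)
        emptyʳ (inj₂ (inj₂ h)) v v∈ c<v v<b with undivided c b c∈ b∈ (has⁻ D c b h)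
        ... | _ , _ , _ , inj₁ none = none v v∈ (c<v , v<b)
        ... | _ , _ , _ , inj₂ all  = <⇒≱ a<c (proj₁ (all a a∈))
        covers : ∀ v → v ∈ S → v List.∈ a ∷ c ∷ b ∷ []
        covers v v∈ with m≤n⇒m<n∨m≡n (minimum v v∈) | m≤n⇒m<n∨m≡n (maximum v v∈) | <-cmp (toℕ v) (toℕ c)
        ... | inj₂ a≡v | _ | _ = here (toℕ-injective (sym a≡v))
        ... | _ | inj₂ v≡b | _ = there (there (here (toℕ-injective v≡b)))
        ... | _ | _ | tri≈ _ v≡c _ = there (here (toℕ-injective v≡c))
        ... | inj₁ a<v | _ | tri< v<c _ _ = contradiction v<c (emptyˡ ac v v∈ a<v)
        ... | _ | inj₁ v<b | tri> _ _ c<v = contradiction v<b (emptyʳ cb v v∈ c<v)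
      -- The neighbours i and j of c in `S` form an edge passing over c, which is ab by `straddle`;
      -- then `S` has no vertex but a and b.
      ... | no c∉
        with _ , a≤i , i≤c , (i , refl , i∈) , max ← greatest in? (toℕ a) (toℕ c) (<⇒≤ a<c) (In⁺ a∈)
        with _ , c≤j , (j , refl , j∈) , min ← least in? (toℕ c) (toℕ b ∸ toℕ c)
               (b , sym (m+[n∸m]≡n (<⇒≤ c<b)) , b∈) = ⊥-elim contra
        where
        i<c : toℕ i < toℕ c
        i<c = ≤∧≢⇒< i≤c λ i≡c → c∉ (subst (_∈ S) (toℕ-injective i≡c) i∈)
        c<j : toℕ c < toℕ j
        c<j = ≤∧≢⇒< c≤j λ c≡j → c∉ (subst (_∈ S) (toℕ-injective (sym c≡j)) j∈)
        none : ∀ k → k ∈ S → ¬ (toℕ i < toℕ k × toℕ k < toℕ j)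
        none k k∈ (i<k , k<j) with ≤-total (toℕ k) (toℕ c)
        ... | inj₁ k≤c = max (toℕ k) i<k k≤c (In⁺ k∈)
        ... | inj₂ c≤k = min (toℕ k) c≤k k<j (In⁺ k∈)
        contra : ⊥
        contra with edge⇒⁺ i j (i∈ , j∈ , <-trans i<c c<j , inj₁ none)
        ... | inj₁ j≡ = <⇒≱ c<j (subst (_≤ toℕ c) (sym j≡) i<c)
        ... | inj₂ ij with i≡a , j≡b ← straddle tri ac cb ij a≤i (maximum j j∈) i<c c<j =
          inner λ v v∈ a<v v<b → none v v∈ (subst (_< toℕ v) (sym i≡a) a<v , subst (toℕ v <_) (sym j≡b) v<b)

  ⇒Triangulation : Triangulation D
  ⇒Triangulation = record
    { nonCrossingDiagonals = ⇒NonCrossingDiagonals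
    ; regionsAreTriangles  = λ S → triangle }

-- Triangulations as the matrices of trees without their root

Diag : ℕ → Shape → ℕ → ℕ → Set
Diag p t i j = Node 0 t i j × ¬ (i ≡ 0 × j ≡ suc p)

diag? : ∀ p t i j → Dec (Diag p t i j)
diag? p t i j = node? 0 t i j ×-dec ¬? (i ≟ 0 ×-dec j ≟ suc p)

abstract

  diagonalsFrom : ∀ p → Shape → Fin (suc (suc p)) → Subset (suc (suc p))
  diagonalsFrom p t u = subset λ v → diag? p t (toℕ u) (toℕ v)

  diagonals : ∀ p → Shape → Segments (suc (suc p))
  diagonals p t = tabulate (diagonalsFrom p t)

  ∈-diagonals⁺ : ∀ {p t u v} → Diag p t (toℕ u) (toℕ v) → diagonals p t ∋⟨ u , v ⟩
  ∈-diagonals⁺ {p} {t} {u} {v} d =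
    subst (v ∈_) (sym (lookup∘tabulate (diagonalsFrom p t) u)) (∈-subset⁺ (λ v → diag? p t (toℕ u) (toℕ v)) d)

  ∈-diagonals⁻ : ∀ {p t u v} → diagonals p t ∋⟨ u , v ⟩ → Diag p t (toℕ u) (toℕ v)
  ∈-diagonals⁻ {p} {t} {u} {v} d =
    ∈-subset⁻ (λ v → diag? p t (toℕ u) (toℕ v)) (subst (v ∈_) (lookup∘tabulate (diagonalsFrom p t) u) d)

vertex : ∀ {n} i → i < n → Σ[ u ∈ Fin n ] toℕ u ≡ i
vertex i i<n = fromℕ< i<n , toℕ-fromℕ< i<n

Node-vertices : ∀ {t i j} → Node 0 t i j →
  (Σ[ u ∈ Fin (suc (suc (size t))) ] toℕ u ≡ i) × (Σ[ v ∈ Fin (suc (suc (size t))) ] toℕ v ≡ j)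
Node-vertices {t} ij with _ , i<j , j≤ ← Node-bounds 0 t ij =
  vertex _ (s≤s (≤-trans (<⇒≤ (<-trans (n<1+n _) i<j)) j≤)) , vertex _ (s≤s j≤)

has-diagonals⁺ : ∀ t {i j} → Diag (size t) t i j → Has (diagonals (size t) t) i j
has-diagonals⁺ t d@(ij , _) with (u , refl) , (v , refl) ← Node-vertices {t} ij =
  u , v , refl , refl , ∈-diagonals⁺ {size t} {t} d

below-diagonals : ∀ l r i j → let t = node l r in Node 0 t i j ⇔ Below (diagonals (size t) t) i j
below-diagonals l r i j = mk⇔ to from
  where
  t = node l r
  to : Node 0 t i j → Below (diagonals (size t) t) i j
  to ij with i ≟ 0 ×-dec j ≟ suc (size t)
  ... | yes (i≡0 , j≡) = inj₁ (i≡0 , cong suc j≡)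
  ... | no ≢           = inj₂ (has-diagonals⁺ t (ij , ≢))
  from : Below (diagonals (size t) t) i j → Node 0 t i j
  from (inj₁ (refl , refl)) = inj₁ (refl , refl)
  from (inj₂ (u , v , refl , refl , d)) = proj₁ (∈-diagonals⁻ {size t} {t} d)

TriangulatesBelow-resp : ∀ {N E F} → (∀ i j → E i j ⇔ F i j) → TriangulatesBelow N E → TriangulatesBelow N F
TriangulatesBelow-resp E⇔F tri = record
  { base = to base ; bounds = bounds ∘ from
  ; nonCrossing = λ ij kl → nonCrossing (from ij) (from kl)
  ; apex = Apex-map to ∘ apex ∘ from }
  where
  open TriangulatesBelow tri
  to = λ {i} {j} → Equivalence.to (E⇔F i j)
  from = λ {i} {j} → Equivalence.from (E⇔F i j)

diagonals-triangulation : ∀ l r → Triangulation (diagonals (size (node l r)) (node l r))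
diagonals-triangulation l r = ⇒Triangulation
  (TriangulatesBelow-resp (below-diagonals l r) (Node-triangulates l r))
  λ { (u , v , refl , refl , d) → proj₂ (∈-diagonals⁻ {size (node l r)} {node l r} d) }

Segments-ext : ∀ {n} {D D′ : Segments n} → (∀ u v → D ∋⟨ u , v ⟩ ⇔ D′ ∋⟨ u , v ⟩) → D ≡ D′
Segments-ext D⇔D′ = lookup-ext λ u → ⊆-antisym (Equivalence.to (D⇔D′ u _)) (Equivalence.from (D⇔D′ u _))
  where
  lookup-ext : ∀ {A : Set} {n} {xs ys : Vec A n} → (∀ i → lookup xs i ≡ lookup ys i) → xs ≡ ys
  lookup-ext {xs = xs} {ys} eq = trans (sym (tabulate∘lookup xs)) (trans (tabulate-cong eq) (tabulate∘lookup ys))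

Triangulation⇒diagonals : ∀ {p} → 1 ≤ p → {D : Segments (suc (suc p))} → Triangulation D →
  Σ[ t ∈ Shape ] size t ≡ p × D ≡ diagonals p t
Triangulation⇒diagonals {p} 1≤p {D} tri with t , refl , eqv ← toShape (Triangulation⇒ 1≤p tri) =
  t , refl , Segments-ext λ u v → mk⇔ (to u v) (from u v)
  where
  open NonCrossingDiagonals (Triangulation.nonCrossingDiagonals tri) using () renaming (diagonals to diagonal)
  to : ∀ u v → D ∋⟨ u , v ⟩ → diagonals p t ∋⟨ u , v ⟩
  to u v d = ∈-diagonals⁺ {p} {t} (Equivalence.from (eqv (toℕ u) (toℕ v)) (inj₂ (u , v , refl , refl , d)) ,
    λ (u≡0 , v≡N) → proj₂ (diagonal u v d) (proj₁ (diagonal u v d) , inj₂ (u≡0 , cong suc v≡N)))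
  from : ∀ u v → diagonals p t ∋⟨ u , v ⟩ → D ∋⟨ u , v ⟩
  from u v d with uv , ≢ ← ∈-diagonals⁻ {p} {t} d with Equivalence.to (eqv (toℕ u) (toℕ v)) uv
  ... | inj₁ (u≡0 , v≡) = contradiction (u≡0 , suc-injective v≡) ≢
  ... | inj₂ h = has⁻ D u v h

diagonals-injective : ∀ {p t t′} → size t ≡ p → size t′ ≡ p → diagonals p t ≡ diagonals p t′ → t ≡ t′
diagonals-injective {t = leaf} {leaf} refl refl _ = refl
diagonals-injective {t = t@(node _ _)} {t′@(node l r)} refl size≡ eq = Node-injective 0 t t′ (sym size≡) sub
  where
  sub : ∀ i j → Node 0 t i j → Node 0 t′ i j
  sub i j ij with i ≟ 0 ×-dec j ≟ suc (size t)
  ... | yes (i≡0 , j≡) = inj₁ (i≡0 , trans j≡ (cong suc (sym size≡)))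
  ... | no ≢ with (u , refl) , (v , refl) ← Node-vertices {t} ij =
    proj₁ (∈-diagonals⁻ {size t} {t′} (subst (_∋⟨ u , v ⟩) eq (∈-diagonals⁺ {size t} {t} (ij , ≢))))

-- Ears

∈-elements⁻ : ∀ {n x} (xs : List (Fin n)) → x ∈ elements xs → x List.∈ xs
∈-elements⁻ []       x∈ = contradiction x∈ ∉⊥
∈-elements⁻ (y ∷ xs) x∈ with x∈p∪q⁻ ⁅ y ⁆ (elements xs) x∈
... | inj₁ x∈y  = here (x∈⁅y⁆⇒x≡y y x∈y)
... | inj₂ x∈xs = there (∈-elements⁻ xs x∈xs)

Contains : ∀ {n} → Subset n → ℕ → Set
Contains S w = Σ[ u ∈ Fin _ ] toℕ u ≡ w × u ∈ S

-- Recording the three vertices as numbers lets two ears be told apart by a single vertex.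
EarOn : ∀ {n} → Segments n → ℕ → ℕ → ℕ → Set
EarOn D x y z = Σ[ S ∈ Subset _ ] Ear D S × (∀ w → Contains S w ⇔ (w ≡ x ⊎ w ≡ y ⊎ w ≡ z))

-- Each constructor is named after the one edge of the triangle that is a diagonal; when this is not
-- xz, the side xz closes the polygon.
data EarSides {n} (D : Segments n) (x y z : Fin n) : Set where
  base-xz : Side x y → Side y z → D ∋⟨ x , z ⟩ → EarSides D x y z
  base-xy : D ∋⟨ x , y ⟩ → Side y z → Side x z → EarSides D x y z
  base-yz : Side x y → D ∋⟨ y , z ⟩ → Side x z → EarSides D x y z

two-sides : ∀ {n} {S : Subset n} (P Q R : Fin n × Fin n) → P ≢ Q →
  let E = λ ((i , j) : Fin n × Fin n) → Edge S i j in let Z = λ ((i , j) : Fin n × Fin n) → Side i j in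
  (∀ e → E e → e ≡ P ⊎ e ≡ Q ⊎ e ≡ R) → E P → E Q → Z P → Z Q → ¬ Z R →
  HasCount (λ e → E e × Z e) 2
two-sides {S = S} P Q R P≢Q edges eP eQ zP zQ ¬zR =
  P ∷ Q ∷ [] , (P≢Q ∷ []) ∷ [] ∷ [] , (λ e → mk⇔ to (from e)) , refl
  where
  to : ∀ {e} → e List.∈ P ∷ Q ∷ [] → Edge S (proj₁ e) (proj₂ e) × Side (proj₁ e) (proj₂ e)
  to (here refl) = eP , zP
  to (there (here refl)) = eQ , zQ
  from : ∀ e → Edge S (proj₁ e) (proj₂ e) × Side (proj₁ e) (proj₂ e) → e List.∈ P ∷ Q ∷ []
  from e (ee , ze) with edges e ee
  ... | inj₁ refl = here refl
  ... | inj₂ (inj₁ refl) = there (here refl)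
  ... | inj₂ (inj₂ refl) = contradiction ze ¬zR

module _ {n} {D : Segments n} (ncd : NonCrossingDiagonals D) {x y z : Fin n}
  (x<y : toℕ x < toℕ y) (y<z : toℕ y < toℕ z) where
  open NonCrossingDiagonals ncd renaming (diagonals to diagonal)

  private
    xyz : List (Fin n)
    xyz = x ∷ y ∷ z ∷ []

    S : Subset n
    S = elements xyz

    x∈ : x ∈ S
    x∈ = ∈-elements {xs = xyz} (here refl)
    y∈ : y ∈ S
    y∈ = ∈-elements {xs = xyz} (there (here refl))
    z∈ : z ∈ S
    z∈ = ∈-elements {xs = xyz} (there (there (here refl)))

    x<z : toℕ x < toℕ z
    x<z = <-trans x<y y<z

    cases : ∀ {v} → v ∈ S → v ≡ x ⊎ v ≡ y ⊎ v ≡ z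
    cases v∈ with ∈-elements⁻ xyz v∈
    ... | here v≡ = inj₁ v≡
    ... | there (here v≡) = inj₂ (inj₁ v≡)
    ... | there (there (here v≡)) = inj₂ (inj₂ v≡)

    edge-xy : Edge S x y
    edge-xy = x∈ , y∈ , x<y , inj₁ none
      where
      none : ∀ k → k ∈ S → ¬ (toℕ x < toℕ k × toℕ k < toℕ y)
      none k k∈ (x<k , k<y) with cases k∈
      ... | inj₁ refl = <-irrefl refl x<k
      ... | inj₂ (inj₁ refl) = <-irrefl refl k<y
      ... | inj₂ (inj₂ refl) = <-asym y<z k<y

    edge-yz : Edge S y z
    edge-yz = y∈ , z∈ , y<z , inj₁ none
      where
      none : ∀ k → k ∈ S → ¬ (toℕ y < toℕ k × toℕ k < toℕ z)
      none k k∈ (y<k , k<z) with cases k∈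
      ... | inj₁ refl = <-asym x<y y<k
      ... | inj₂ (inj₁ refl) = <-irrefl refl y<k
      ... | inj₂ (inj₂ refl) = <-irrefl refl k<z

    edge-xz : Edge S x z
    edge-xz = x∈ , z∈ , x<z , inj₂ all
      where
      all : ∀ k → k ∈ S → toℕ x ≤ toℕ k × toℕ k ≤ toℕ z
      all k k∈ with cases k∈
      ... | inj₁ refl = ≤-refl , <⇒≤ x<z
      ... | inj₂ (inj₁ refl) = <⇒≤ x<y , <⇒≤ y<z
      ... | inj₂ (inj₂ refl) = <⇒≤ x<z , ≤-refl

    Pairs : Fin n × Fin n → Set
    Pairs e = e ≡ (x , y) ⊎ e ≡ (y , z) ⊎ e ≡ (x , z)

    pairs : ∀ {i j} → i ∈ S → j ∈ S → toℕ i < toℕ j → Pairs (i , j)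
    pairs i∈ j∈ i<j with cases i∈ | cases j∈
    ... | inj₁ refl        | inj₁ refl        = contradiction i<j (<-irrefl refl)
    ... | inj₁ refl        | inj₂ (inj₁ refl) = inj₁ refl
    ... | inj₁ refl        | inj₂ (inj₂ refl) = inj₂ (inj₂ refl)
    ... | inj₂ (inj₁ refl) | inj₁ refl        = contradiction i<j (<-asym x<y)
    ... | inj₂ (inj₁ refl) | inj₂ (inj₁ refl) = contradiction i<j (<-irrefl refl)
    ... | inj₂ (inj₁ refl) | inj₂ (inj₂ refl) = inj₂ (inj₁ refl)
    ... | inj₂ (inj₂ refl) | inj₁ refl        = contradiction i<j (<-asym x<z)
    ... | inj₂ (inj₂ refl) | inj₂ (inj₁ refl) = contradiction i<j (<-asym y<z)
    ... | inj₂ (inj₂ refl) | inj₂ (inj₂ refl) = contradiction i<j (<-irrefl refl)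

    edge⇒pair : ∀ e → Edge S (proj₁ e) (proj₂ e) → Pairs e
    edge⇒pair e (i∈ , j∈ , i<j , _) = pairs i∈ j∈ i<j

    pair⇒edge : ∀ {i j} → Pairs (i , j) → Edge S i j
    pair⇒edge (inj₁ refl)        = edge-xy
    pair⇒edge (inj₂ (inj₁ refl)) = edge-yz
    pair⇒edge (inj₂ (inj₂ refl)) = edge-xz

    ≢-proj₁ : ∀ {i j k l : Fin n} → toℕ i < toℕ k → (i , j) ≢ (k , l)
    ≢-proj₁ i<k refl = <-irrefl refl i<k

    ≢-proj₂ : ∀ {i j k l : Fin n} → toℕ j < toℕ l → (i , j) ≢ (k , l)
    ≢-proj₂ j<l refl = <-irrefl refl j<l

    <⇒≢ᶠ : ∀ {i j : Fin n} → toℕ i < toℕ j → i ≢ j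
    <⇒≢ᶠ i<j refl = <-irrefl refl i<j

    unique : Unique xyz
    unique = (<⇒≢ᶠ x<y ∷ <⇒≢ᶠ x<z ∷ []) ∷ (<⇒≢ᶠ y<z ∷ []) ∷ [] ∷ []

    three : 3 ≤ ∣ S ∣
    three = length≤∣∣ unique (x∈ ∷ y∈ ∷ z∈ ∷ [])

  -- Any two vertices of a triangle form an edge of it, so nothing can divide it, and a diagonal is
  -- never a side, so exactly two edges are sides.
  ear : EarSides D x y z → EarOn D (toℕ x) (toℕ y) (toℕ z)
  ear sides = S , (region , ≤-antisym (∣elements∣≤length xyz) three , sideCount sides) , λ w → mk⇔ to from
    where
    bounded : EarSides D x y z → ∀ {e} → Pairs e → Side (proj₁ e) (proj₂ e) ⊎ D ∋⟨ proj₁ e , proj₂ e ⟩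
    bounded (base-xz xy yz xz) = λ { (inj₁ refl) → inj₁ xy ; (inj₂ (inj₁ refl)) → inj₁ yz ; (inj₂ (inj₂ refl)) → inj₂ xz }
    bounded (base-xy xy yz xz) = λ { (inj₁ refl) → inj₂ xy ; (inj₂ (inj₁ refl)) → inj₁ yz ; (inj₂ (inj₂ refl)) → inj₁ xz }
    bounded (base-yz xy yz xz) = λ { (inj₁ refl) → inj₁ xy ; (inj₂ (inj₁ refl)) → inj₂ yz ; (inj₂ (inj₂ refl)) → inj₁ xz }
    region : Region D S
    region = record
      { polygon   = three
      ; bounded   = λ i j e → bounded sides (edge⇒pair (i , j) e)
      ; undivided = λ i j i∈ j∈ d → pair⇒edge (pairs i∈ j∈ (proj₁ (diagonal i j d))) }
    sideCount : EarSides D x y z → HasCount {A = Fin n × Fin n} (λ (i , j) → Edge S i j × Side i j) 2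
    sideCount (base-xz xy yz xz) = two-sides (x , y) (y , z) (x , z) (≢-proj₁ x<y) edge⇒pair
      edge-xy edge-yz xy yz (proj₂ (diagonal x z xz))
    sideCount (base-xy xy yz xz) = two-sides (x , z) (y , z) (x , y) (≢-proj₁ x<y)
      (λ e ee → Sum.[ inj₂ ∘ inj₂ , Sum.[ inj₂ ∘ inj₁ , inj₁ ] ] (edge⇒pair e ee))
      edge-xz edge-yz xz yz (proj₂ (diagonal x y xy))
    sideCount (base-yz xy yz xz) = two-sides (x , y) (x , z) (y , z) (≢-proj₂ y<z)
      (λ e ee → Sum.[ inj₁ , Sum.[ inj₂ ∘ inj₂ , inj₂ ∘ inj₁ ] ] (edge⇒pair e ee))
      edge-xy edge-xz xy xz (proj₂ (diagonal y z yz))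
    to : ∀ {w} → Contains S w → w ≡ toℕ x ⊎ w ≡ toℕ y ⊎ w ≡ toℕ z
    to (u , refl , u∈) = Sum.map (cong toℕ) (Sum.map (cong toℕ) (cong toℕ)) (cases u∈)
    from : ∀ {w} → w ≡ toℕ x ⊎ w ≡ toℕ y ⊎ w ≡ toℕ z → Contains S w
    from (inj₁ refl)        = x , refl , x∈
    from (inj₂ (inj₁ refl)) = y , refl , y∈
    from (inj₂ (inj₂ refl)) = z , refl , z∈

-- Two ears force two chains

three-distinct : ∀ {A : Set} {xs : List A} {x y z : A} → length xs ≡ 2 →
  x List.∈ xs → y List.∈ xs → z List.∈ xs → x ≢ y → x ≢ z → y ≢ z → ⊥
three-distinct {xs = _ ∷ _ ∷ []} refl (here refl) (here refl) _ x≢y _ _ = x≢y refl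
three-distinct {xs = _ ∷ _ ∷ []} refl (here refl) (there (here refl)) (here refl) _ x≢z _ = x≢z refl
three-distinct {xs = _ ∷ _ ∷ []} refl (here refl) (there (here refl)) (there (here refl)) _ _ y≢z = y≢z refl
three-distinct {xs = _ ∷ _ ∷ []} refl (there (here refl)) (there (here refl)) _ x≢y _ _ = x≢y refl
three-distinct {xs = _ ∷ _ ∷ []} refl (there (here refl)) (here refl) (there (here refl)) _ x≢z _ = x≢z refl
three-distinct {xs = _ ∷ _ ∷ []} refl (there (here refl)) (here refl) (here refl) _ _ y≢z = y≢z refl

EarOn-≢ : ∀ {n} {D : Segments n} {x y z x′ y′ z′} (e : EarOn D x y z) (e′ : EarOn D x′ y′ z′) w →
  (w ≡ x ⊎ w ≡ y ⊎ w ≡ z) → w ≢ x′ → w ≢ y′ → w ≢ z′ → proj₁ e ≢ proj₁ e′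
EarOn-≢ (S , _ , S⇔) (_ , _ , S⇔′) w w∈ ≢x ≢y ≢z refl
  with Equivalence.to (S⇔′ w) (Equivalence.from (S⇔ w) w∈)
... | inj₁ eq        = ≢x eq
... | inj₂ (inj₁ eq) = ≢y eq
... | inj₂ (inj₂ eq) = ≢z eq

some-ear : ∀ a l r → Σ[ c ∈ ℕ ] Node a (node l r) c (suc (suc c))
some-ear a leaf leaf = a , inj₁ (refl , cong suc (sym (trans (+-suc a 0) (cong suc (+-identityʳ a)))))
some-ear a (node l l′) r with c , ear ← some-ear a l l′ = c , inj₂ (inj₁ ear)
some-ear a leaf (node r r′) with c , ear ← some-ear (suc (a + 0)) r r′ = c , inj₂ (inj₂ ear)

-- A tree that is no chain has a node with two inner children. Each child has an ear below it, and
-- the apex of the node separates the two ears, whence the gap between c₁ and c₂.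
chain-or-ears : ∀ a t → Chain t ⊎
  Σ[ c₁ ∈ ℕ ] Σ[ c₂ ∈ ℕ ] suc (suc c₁) ≤ c₂ × Node a t c₁ (suc (suc c₁)) × Node a t c₂ (suc (suc c₂))
chain-or-ears a leaf = inj₁ leaf
chain-or-ears a (node leaf t) with chain-or-ears (suc (a + 0)) t
... | inj₁ chain = inj₁ (growˡ chain)
... | inj₂ (c₁ , c₂ , le , e₁ , e₂) = inj₂ (c₁ , c₂ , le , inj₂ (inj₂ e₁) , inj₂ (inj₂ e₂))
chain-or-ears a (node t@(node _ _) leaf) with chain-or-ears a t
... | inj₁ chain = inj₁ (growʳ chain)
... | inj₂ (c₁ , c₂ , le , e₁ , e₂) = inj₂ (c₁ , c₂ , le , inj₂ (inj₁ e₁) , inj₂ (inj₁ e₂))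
chain-or-ears a (node l@(node l₁ l₂) r@(node r₁ r₂))
  with c₁ , e₁ ← some-ear a l₁ l₂ | c₂ , e₂ ← some-ear (suc (a + size l)) r₁ r₂ =
  inj₂ (c₁ , c₂ , ≤-trans (proj₂ (proj₂ (Node-bounds a l e₁))) (proj₁ (Node-bounds _ r e₂)) ,
        inj₂ (inj₁ e₁) , inj₂ (inj₂ e₂))

module _ (l r : Shape) (2≤size : 2 ≤ size (node l r))
         (two : TwoEared (diagonals (size (node l r)) (node l r))) where

  private
    t = node l r
    p = size t
    D = diagonals p t
    ncd = Triangulation.nonCrossingDiagonals (diagonals-triangulation l r)

    at-most-two : ∀ {x y z x′ y′ z′ x″ y″ z″} (e : EarOn D x y z) (e′ : EarOn D x′ y′ z′) (e″ : EarOn D x″ y″ z″) →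
      proj₁ e ≢ proj₁ e′ → proj₁ e ≢ proj₁ e″ → proj₁ e′ ≢ proj₁ e″ → ⊥
    at-most-two (S , ear , _) (S′ , ear′ , _) (S″ , ear″ , _) = let _ , _ , iff , len = two in
      three-distinct len (Equivalence.from (iff S) ear) (Equivalence.from (iff S′) ear′) (Equivalence.from (iff S″) ear″)

    ear-at : ∀ {c} → Node 0 t c (suc (suc c)) → EarOn D c (suc c) (suc (suc c))
    ear-at {c} e with _ , _ , le ← Node-bounds 0 t e
      with x , refl ← vertex {suc (suc p)} c (s≤s (≤-trans (n≤1+n c) (≤-trans (n≤1+n _) le)))
      with y , y≡ ← vertex {suc (suc p)} (suc c) (s≤s (≤-trans (n≤1+n _) le))
      with z , z≡ ← vertex {suc (suc p)} (suc (suc c)) (s≤s le) =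
      subst₂ (EarOn D (toℕ x)) y≡ z≡ (ear ncd x<y y<z
        -- Since p is at least 2, the segment from c to c + 2 is not the root.
        (base-xz (x<y , inj₁ y≡) (y<z , inj₁ (trans z≡ (cong suc (sym y≡))))
          (∈-diagonals⁺ {p} {t} (subst (Node 0 t (toℕ x)) (sym z≡) e ,
            λ (x≡0 , z≡N) → <⇒≢ 2≤size (suc-injective (trans (sym (trans z≡ (cong (suc ∘ suc) x≡0))) z≡N))))))
      where
      x<y : toℕ x < toℕ y
      x<y = ≤-reflexive (sym y≡)
      y<z : toℕ y < toℕ z
      y<z = ≤-reflexive (trans (cong suc y≡) (sym z≡))

    -- This is the triangle at the root when `r` is a leaf; one of its two sides is the one from 0
    -- to p + 1. `ear-first` is the mirror image.
    ear-last : Node 0 t 0 p → EarOn D 0 p (suc p)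
    ear-last e with y , y≡ ← vertex {suc (suc p)} p (n≤1+n _) | z , z≡ ← vertex {suc (suc p)} (suc p) ≤-refl =
      subst₂ (EarOn D 0) y≡ z≡ (ear ncd x<y y<z
        (base-xy (∈-diagonals⁺ {p} {t} (subst (Node 0 t 0) (sym y≡) e , λ (_ , y≡N) → <⇒≢ (n<1+n p) (trans (sym y≡) y≡N)))
          (y<z , inj₁ (trans z≡ (cong suc (sym y≡)))) (<-trans x<y y<z , inj₂ (refl , cong suc z≡))))
      where
      x<y : 0 < toℕ y
      x<y = subst (0 <_) (sym y≡) (s≤s z≤n)
      y<z : toℕ y < toℕ z
      y<z = ≤-reflexive (trans (cong suc y≡) (sym z≡))

    ear-first : Node 0 t 1 (suc p) → EarOn D 0 1 (suc p)
    ear-first e with z , z≡ ← vertex {suc (suc p)} (suc p) ≤-refl =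
      subst (EarOn D 0 1) z≡ (ear ncd {Fin.zero} {Fin.suc Fin.zero} (s≤s z≤n) 1<z
        (base-yz (s≤s z≤n , inj₁ refl)
          (∈-diagonals⁺ {p} {t} (subst (Node 0 t 1) (sym z≡) e , λ ()))
          (<-trans (s≤s z≤n) 1<z , inj₂ (refl , cong suc z≡))))
      where
      1<z : 1 < toℕ z
      1<z = subst (1 <_) (sym z≡) (s≤s (s≤s z≤n))

    apart : ∀ {c c′} (e : EarOn D c (suc c) (suc (suc c))) (e′ : EarOn D c′ (suc c′) (suc (suc c′))) →
      suc (suc c) ≤ c′ → proj₁ e ≢ proj₁ e′
    apart {c} e e′ le = EarOn-≢ e e′ c (inj₁ refl) (<⇒≢ c<c′) (<⇒≢ (m≤n⇒m≤1+n c<c′)) (<⇒≢ (m≤n⇒m≤1+n (m≤n⇒m≤1+n c<c′)))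
      where
      c<c′ = ≤-trans (n≤1+n _) le

  -- Otherwise `l` carries two ears, and a third one is found below `r` or, if `r` is a leaf, at the
  -- root.
  chainˡ : Chain l
  chainˡ with chain-or-ears 0 l
  ... | inj₁ chain = chain
  ... | inj₂ (c₁ , c₂ , le , e₁ , e₂) = ⊥-elim (third r refl)
    where
    E₁ = ear-at (inj₂ (inj₁ e₁))
    E₂ = ear-at (inj₂ (inj₁ e₂))
    c₂≤ : suc (suc c₂) ≤ suc (size l)
    c₂≤ = proj₂ (proj₂ (Node-bounds 0 l e₂))
    third : ∀ s → r ≡ s → ⊥
    third (node r₁ r₂) refl with c₃ , e₃ ← some-ear (suc (size l)) r₁ r₂ =
      at-most-two E₁ E₂ E₃ (apart E₁ E₂ le) (apart E₁ E₃ (≤-trans le (≤-trans (≤-trans (n≤1+n _) (n≤1+n _)) le′))) (apart E₂ E₃ le′)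
      where
      le′ : suc (suc c₂) ≤ c₃
      le′ = ≤-trans c₂≤ (proj₁ (Node-bounds _ r e₃))
      E₃ = ear-at (inj₂ (inj₂ e₃))
    third leaf refl = at-most-two E₁ E₂ E₃ (apart E₁ E₂ le) (other E₁ (≤-trans (≤-trans (≤-trans le (n≤1+n _)) (n≤1+n _)) c₂≤)) (other E₂ c₂≤)
      where
      p≡ : p ≡ suc (size l)
      p≡ = cong suc (+-identityʳ (size l))
      top : ∀ l′ → l ≡ l′ → Node 0 l 0 (suc (size l))
      -- A leaf has no nodes: both the goal and the type of `e₁` are empty here.
      top leaf refl = e₁
      top (node _ _) refl = inj₁ (refl , refl)
      E₃ = ear-last (inj₂ (inj₁ (subst (Node 0 l 0) (sym p≡) (top l refl))))
      other : ∀ {c} (e : EarOn D c (suc c) (suc (suc c))) → suc (suc c) ≤ suc (size l) → proj₁ e ≢ proj₁ E₃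
      other e c≤ eq = EarOn-≢ E₃ e (suc p) (inj₂ (inj₂ refl))
        (>⇒≢ (≤-trans (≤-trans (n≤1+n _) (n≤1+n _)) lt)) (>⇒≢ (≤-trans (n≤1+n _) lt)) (>⇒≢ lt) (sym eq)
        where
        lt = s≤s (≤-trans c≤ (≤-reflexive (sym p≡)))

  chainʳ : Chain r
  chainʳ with chain-or-ears (suc (size l)) r
  ... | inj₁ chain = chain
  ... | inj₂ (c₁ , c₂ , le , e₁ , e₂) = ⊥-elim (third l refl)
    where
    E₁ = ear-at (inj₂ (inj₂ e₁))
    E₂ = ear-at (inj₂ (inj₂ e₂))
    ≤c₁ : suc (size l) ≤ c₁
    ≤c₁ = proj₁ (Node-bounds _ r e₁)
    third : ∀ s → l ≡ s → ⊥
    third (node l₁ l₂) refl with c₃ , e₃ ← some-ear 0 l₁ l₂ =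
      at-most-two E₃ E₁ E₂ (apart E₃ E₁ le′) (apart E₃ E₂ (≤-trans le′ (≤-trans (≤-trans (n≤1+n _) (n≤1+n _)) le))) (apart E₁ E₂ le)
      where
      le′ : suc (suc c₃) ≤ c₁
      le′ = ≤-trans (proj₂ (proj₂ (Node-bounds 0 l e₃))) ≤c₁
      E₃ = ear-at (inj₂ (inj₁ e₃))
    third leaf refl = at-most-two E₁ E₂ E₃ (apart E₁ E₂ le) (other E₁ ≤c₁) (other E₂ (≤-trans ≤c₁ (≤-trans (≤-trans (n≤1+n _) (n≤1+n _)) le)))
      where
      top : ∀ r′ → r ≡ r′ → Node 1 r 1 (suc (suc (size r)))
      top leaf refl = e₁
      top (node _ _) refl = inj₁ (refl , refl)
      E₃ = ear-first (inj₂ (inj₂ (top r refl)))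
      other : ∀ {c} (e : EarOn D c (suc c) (suc (suc c))) → 1 ≤ c → proj₁ e ≢ proj₁ E₃
      other e c≥1 eq = EarOn-≢ E₃ e 0 (inj₁ refl) (<⇒≢ c≥1) (λ ()) (λ ()) (sym eq)

-- Counting the disjoint triangulations

Unique-map : ∀ {A B : Set} (f : A → B) {xs : List A} → (∀ {x y} → x List.∈ xs → y List.∈ xs → f x ≡ f y → x ≡ y) →
  Unique xs → Unique (map f xs)
Unique-map f inj [] = []
Unique-map f inj (x∉ ∷ uniq) =
  All.map⁺ (All.tabulate λ y∈ eq → All.lookup x∉ y∈ (inj (here refl) (there y∈) eq)) ∷
  Unique-map f (λ x∈ y∈ → inj (there x∈) (there y∈)) uniq

ShapeOf : ∀ p → (Shape → Set) → Segments (suc (suc p)) → Set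
ShapeOf p P U = Σ[ t ∈ Shape ] size t ≡ p × P t × U ≡ diagonals p t

count-avoiding : ∀ p χ → HasCount (ShapeOf p (Avoids χ 0)) (count χ 0 p)
count-avoiding p χ = map (diagonals p) (shapes χ 0 p) ,
  -- Injectivity is asked on the list alone: `diagonals p` identifies some shapes whose size is not
  -- p.
  Unique-map (diagonals p) (λ t∈ t′∈ → diagonals-injective (proj₁ (∈-shapes′⁻ χ p 0 p t∈)) (proj₁ (∈-shapes′⁻ χ p 0 p t′∈)))
    (shapes′-unique χ p 0 p) ,
  (λ U → mk⇔ to from) ,
  length-map (diagonals p) (shapes χ 0 p)
  where
  to : ∀ {U} → U List.∈ map (diagonals p) (shapes χ 0 p) → ShapeOf p (Avoids χ 0) U
  to U∈ with t , t∈ , U≡ ← ∈-map⁻ (diagonals p) U∈ with size≡ , avoids ← ∈-shapes′⁻ χ p 0 p t∈ =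
    t , size≡ , avoids , U≡
  from : ∀ {U} → ShapeOf p (Avoids χ 0) U → U List.∈ map (diagonals p) (shapes χ 0 p)
  from (t , refl , avoids , refl) = ∈-map⁺ (diagonals p) (∈-shapes′⁺ χ p 0 t ≤-refl avoids)

HasCount-resp : ∀ {A : Set} {P Q : A → Set} {k m} → (∀ x → P x ⇔ Q x) → k ≡ m → HasCount P k → HasCount Q m
HasCount-resp P⇔Q refl (xs , unique , iff , len) = xs , unique , (λ x → mk⇔
  (λ x∈ → Equivalence.to (P⇔Q x) (Equivalence.to (iff x) x∈))
  (λ q → Equivalence.from (iff x) (Equivalence.from (P⇔Q x) q))) , len

innerNodes⇒Diag : ∀ l r i s → innerNodes l r i s ≡ true → Diag (size (node l r)) (node l r) i (suc (i + s))
innerNodes⇒Diag l r i s eq with ∨-true (nodes 0 l i s) _ eq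
... | inj₁ inl with ij ← nodes⇒Node 0 l i s inl = inj₂ (inj₁ ij) , λ (_ , j≡) →
  <⇒≢ (s≤s (≤-trans (proj₂ (proj₂ (Node-bounds 0 l ij))) (s≤s (m≤m+n (size l) (size r))))) j≡
... | inj₂ inr with ij ← nodes⇒Node (suc (size l)) r i s inr = inj₂ (inj₂ ij) , λ (i≡0 , _) →
  <⇒≢ (≤-trans (s≤s z≤n) (proj₁ (Node-bounds _ r ij))) (sym i≡0)

Diag⇒innerNodes : ∀ l r i s → Diag (size (node l r)) (node l r) i (suc (i + s)) → innerNodes l r i s ≡ true
Diag⇒innerNodes l r i s (inj₁ top , ≢) = contradiction top ≢
Diag⇒innerNodes l r i s (inj₂ (inj₁ inl) , _) rewrite Node⇒nodes 0 l i s inl = refl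
Diag⇒innerNodes l r i s (inj₂ (inj₂ inr) , _) rewrite Node⇒nodes (suc (size l)) r i s inr = ∨-zeroʳ _

module _ (l r : Shape) where

  private
    p = size (node l r)
    χ = innerNodes l r

  avoids⇒disjoint : ∀ {t} → Avoids χ 0 t → Disjoint (diagonals p (node l r)) (diagonals p t)
  avoids⇒disjoint {t} avoids u v (d , d′) = contradiction
    (trans (sym (Diag⇒innerNodes l r (toℕ u) s (subst (Diag p (node l r) (toℕ u)) v≡ (∈-diagonals⁻ {p} {node l r} d))))
           (Avoids⁻ χ 0 t avoids (toℕ u) s (subst (Node 0 t (toℕ u)) v≡ uv))) λ ()
    where
    uv = proj₁ (∈-diagonals⁻ {p} {t} d′)
    -- The size of the segment uv, that is, the number of vertices strictly between its ends.
    s = toℕ v ∸ suc (toℕ u)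
    v≡ : toℕ v ≡ suc (toℕ u + s)
    v≡ = sym (m+[n∸m]≡n (<⇒≤ (proj₁ (proj₂ (Node-bounds 0 t uv)))))

  disjoint⇒avoids : ∀ {t} → size t ≡ p → Disjoint (diagonals p (node l r)) (diagonals p t) → Avoids χ 0 t
  disjoint⇒avoids {t} size≡ disjoint = Avoids⁺ χ 0 t λ i s ij → ¬-not λ eq →
    common (innerNodes⇒Diag l r i s eq) ij
    where
    common : ∀ {i j} → Diag p (node l r) i j → Node 0 t i j → ⊥
    common d@(ij , ≢) ij′ with (u , refl) , (v , refl) ← Node-vertices {node l r} ij =
      disjoint u v (∈-diagonals⁺ {p} {node l r} d , ∈-diagonals⁺ {p} {t} (ij′ , ≢))

  disjoint-triangulation : ∀ U → ShapeOf p (Avoids χ 0) U ⇔ (Triangulation U × Disjoint (diagonals p (node l r)) U)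
  disjoint-triangulation U = mk⇔ to from
    where
    triangulation : ∀ t → size t ≡ p → Triangulation (diagonals p t)
    triangulation t@(node x y) size≡ = subst (λ q → Triangulation (diagonals q t)) size≡ (diagonals-triangulation x y)
    to : ShapeOf p (Avoids χ 0) U → Triangulation U × Disjoint (diagonals p (node l r)) U
    to (t , size≡ , avoids , U≡) = subst (λ U → Triangulation U × Disjoint (diagonals p (node l r)) U) (sym U≡)
      (triangulation t size≡ , avoids⇒disjoint {t} avoids)
    from : Triangulation U × Disjoint (diagonals p (node l r)) U → ShapeOf p (Avoids χ 0) U
    from (tri , disjoint) = let t , size≡ , U≡ = Triangulation⇒diagonals {p} (s≤s z≤n) tri in
      t , size≡ , disjoint⇒avoids {t} size≡ (subst (Disjoint (diagonals p (node l r))) U≡ disjoint) , U≡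

  count-disjoint-triangulations : 2 ≤ p → TwoEared (diagonals p (node l r)) →
    HasCount (λ U → Triangulation U × Disjoint (diagonals p (node l r)) U) (catalan (size l + size r))
  count-disjoint-triangulations 2≤p two =
    HasCount-resp disjoint-triangulation
      (trans (count-disjoint (chainˡ l r 2≤p two) (chainʳ l r 2≤p two)) (cat≡catalan (size l + size r)))
      (count-avoiding p χ)

theorem3p1 : (n : ℕ) → 4 ≤ n →
    (T : Segments n) → Triangulation T → TwoEared T →
    HasCount (λ (U : Segments n) → Triangulation U × Disjoint T U) (catalan (n ∸ 3))
theorem3p1 (suc (suc p)) (s≤s (s≤s 2≤p)) T tri two
  with Triangulation⇒diagonals (≤-trans (n≤1+n 1) 2≤p) tri
... | leaf , refl , _ = contradiction 2≤p λ ()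
-- Here n = p + 2 and p = size l + size r + 1, so n - 3 is the total size of the two chains.
... | node l r , refl , refl = count-disjoint-triangulations l r 2≤p two
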